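{- Let $P$ be an Eulerian binomial poset with factorial function $B(n)$. Then exactly one of the following holds: (i) $B(n) = n!$ for all $n \geq 0$, and every $n$-interval of $P$ is isomorphic to the Boolean algebra $B_n$; or (ii) $B(0)=1$ and $B(n) = 2^{n-1}$ for all $n \geq 1$, and every $n$-interval of $P$ is isomorphic to the butterfly poset $T_n$.
   Context: All posets are locally finite with a unique minimal element $\hat{0}$. A binomial poset is such a poset $P$ that (i) contains an infinite chain, (ii) has every interval $[x,y]$ graded (so $P$ has a rank function $\rho$ with $\rho(\hat 0)=0$; $[x,y]$ is an $n$-interval if $\rho(y)-\rho(x)=n$), and (iii) for every $n\in\mathbb{N}$ any two $n$-intervals have the same number $B(n)$ of maximal chains; $B$ is the factorial function. A graded poset is Eulerian if its Möbius function satisfies $\mu(x,y) = (-1)^{\rho(y)-\rho(x)}$ for all $x \leq y$. $B_n$ is the Boolean algebra of all subsets of an $n$-element set ordered by inclusion. The butterfly poset $T_n$ ($n\ge 1$) is the graded poset of rank $n$ with a minimum $\hat 0$, a maximum $\hat 1$, and exactly two elements of each rank $1,\dots,n-1$, where every element of rank $k$ is below every element of rank $k+1$ (equivalently, an $n$-interval of the infinite butterfly poset $\{\hat 0\}\cup(\mathbb{P}\times\{1,2\})$ with $(k,i)\prec(k+1,j)$ for all $i,j$). -}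

module Defs where

open import Level using (0ℓ)
open import Data.Nat using (ℕ; zero; suc; _<_; _∸_)
open import Data.Integer using (ℤ; -1ℤ; 0ℤ; 1ℤ) renaming (_^_ to _^ℤ_; _+_ to _+ℤ_)

open import Data.List using (List; []; _∷_; map; length; foldr)
open import Data.List.Membership.Propositional using (_∈_)
open import Data.List.Relation.Unary.Unique.Propositional using (Unique)
open import Data.Fin using (Fin; toℕ)
open import Data.Bool using (Bool)
open import Data.Product using (Σ; _×_; ∃)
open import Data.Sum using (_⊎_)
open import Relation.Nullary using (¬_)
open import Relation.Binary.PropositionalEquality using (_≡_; _≢_)
open import Relation.Binary.Structures using (IsPartialOrder)
open import Function.Bundles using (_⇔_)

sumℤ : List ℤ → ℤ
sumℤ = foldr _+ℤ_ 0ℤ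

record LFPoset : Set₁ where
  field
    Carrier        : Set
    _≤_            : Carrier → Carrier → Set
    isPartialOrder : IsPartialOrder _≡_ _≤_
    𝟘              : Carrier
    𝟘-least        : ∀ x → 𝟘 ≤ x
    interval       : Carrier → Carrier → List Carrier
    interval-uniq  : ∀ x y → Unique (interval x y)
    interval-mem   : ∀ x y z → (z ∈ interval x y) ⇔ (x ≤ z × z ≤ y)

module _ (P : LFPoset) where
  open LFPoset P

  _<ₚ_ : Carrier → Carrier → Set
  x <ₚ y = x ≤ y × x ≢ y

  _⋖_ : Carrier → Carrier → Set
  x ⋖ y = x <ₚ y × (∀ z → x ≤ z → z ≤ y → (z ≡ x) ⊎ (z ≡ y))

  -- rank function: ρ(0̂) = 0 and covers raise rank by one
  -- (equivalent to all intervals being graded, P having 0̂)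
  IsRankFunction : (Carrier → ℕ) → Set
  IsRankFunction ρ = (ρ 𝟘 ≡ 0) × (∀ x y → x ⋖ y → ρ y ≡ suc (ρ x))

  HasInfiniteChain : Set
  HasInfiniteChain = Σ (ℕ → Carrier) λ c → ∀ i → c i <ₚ c (suc i)

  data MaxChain : Carrier → Carrier → List Carrier → Set where
    single : ∀ x → MaxChain x x (x ∷ [])
    step   : ∀ {x y z cs} → x ⋖ y → MaxChain y z cs → MaxChain x z (x ∷ cs)

  NumMaxChains : Carrier → Carrier → ℕ → Set
  NumMaxChains x y k = Σ (List (List Carrier)) λ L →
    (length L ≡ k) × Unique L × (∀ c → (c ∈ L) ⇔ MaxChain x y c)

  IsFactorialFunction : (Carrier → ℕ) → (ℕ → ℕ) → Set
  IsFactorialFunction ρ B = ∀ n x y → x ≤ y → ρ y ≡ n Data.Nat.+ ρ x → NumMaxChains x y (B n)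

  IsMobius : (Carrier → Carrier → ℤ) → Set
  IsMobius μ = (∀ x → μ x x ≡ 1ℤ) ×
               (∀ x y → x <ₚ y → sumℤ (map (μ x) (interval x y)) ≡ 0ℤ)

  IsEulerian : (Carrier → ℕ) → Set
  IsEulerian ρ = ∀ μ → IsMobius μ → ∀ x y → x ≤ y → μ x y ≡ -1ℤ ^ℤ (ρ y ∸ ρ x)

  IntervalIso : Carrier → Carrier → (Q : Set) → (Q → Q → Set) → Set
  IntervalIso x y Q _⊑_ = Σ (Q → Carrier) λ f →
      (∀ a → x ≤ f a × f a ≤ y)
    × (∀ z → x ≤ z → z ≤ y → ∃ λ a → f a ≡ z)
    × (∀ a b → (f a ≤ f b) ⇔ (a ⊑ b))

open import Data.Fin.Subset using (Subset; _⊆_)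

BoolAlg : ℕ → Set
BoolAlg = Subset

_⊆B_ : ∀ {n} → BoolAlg n → BoolAlg n → Set
_⊆B_ = _⊆_

-- Butterfly poset T_n (meant for n ≥ 1): 0̂, 1̂, and two elements
-- mid j b of each rank suc (toℕ j) ∈ {1,…,n-1}
data Butterfly (n : ℕ) : Set where
  bot : Butterfly n
  top : Butterfly n
  mid : Fin (n ∸ 1) → Bool → Butterfly n

bRank : ∀ {n} → Butterfly n → ℕ
bRank bot = 0
bRank {n} top = n
bRank (mid j _) = suc (toℕ j)

_≤T_ : ∀ {n} → Butterfly n → Butterfly n → Set
a ≤T b = (a ≡ b) ⊎ (bRank a < bRank b)

{-# OPTIONS --safe #-}
-- Splitting maximal chains at rank r gives B(n) = W(n,r) B(r) B(n−r), where W(n,r) counts the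
-- elements of rank r in an n-interval; the Eulerian condition says that W(n,·) has alternating sum 0.
-- Write A(n) = W(n,1) = B(n)/B(n−1), a nondecreasing function with A(2) = 2. If B agrees with
-- the factorial below 2m−1, the relation in rank 2m reads 2m = A(2m)(2m − A(2m−1)), which forces
-- A(2m−1) = 2m−1 and A(2m) = 2m unless m = 2 and A(3) = A(4) = 2. If instead B(k) = 2^(k−1) below 2m−1,
-- it reads 4 = A(2m)(4 − A(2m−1)), so A(2m−1) is 2 or 3, and 3 is impossible because the atoms would
-- pair up: two rank-2 elements over a common atom have the same two atoms.
-- If A(n) = 2 for n ≥ 2, each rank of an interval lies entirely below the next. If A(n) = n,
-- each coatom misses exactly one atom and conversely, and by induction through coatoms
-- z ↦ {atoms below z} is an isomorphism onto all sets of atoms.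
module Submission where

open import Defs
open import Data.Bool using (Bool; true; false)
open import Data.Empty using (⊥; ⊥-elim)
open import Data.Fin using (Fin; zero; suc; toℕ; fromℕ<)
import Data.Fin.Properties as Finₚ
open import Data.Fin.Subset as Subset using (Subset)
import Data.Fin.Subset.Properties as Subsetₚ
open import Data.Integer as ℤ using (ℤ; +_; 0ℤ; 1ℤ; -1ℤ)
import Data.Integer.Properties as ℤₚ
import Data.Integer.Tactic.RingSolver as ℤ-Ring
open import Data.List using (List; []; _∷_; map; length; lookup; _++_; take; drop; filter; cartesianProduct)
open import Data.List.Membership.Propositional using (_∈_; find; lose)
open import Data.List.Membership.Propositional.Properties
open import Data.List.Properties using (length-++; length-map; take++drop≡id; drop-drop; filter-accept; filter-reject; filter-all; map-cong-local)
open import Data.List.Relation.Unary.All as All using (All; []; _∷_)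
open import Data.List.Relation.Unary.AllPairs using ([]; _∷_)
open import Data.List.Relation.Unary.Any as Any using (here; there; any?)
import Data.List.Relation.Unary.Any.Properties as Anyₚ
open import Data.List.Relation.Unary.Unique.Propositional using (Unique)
open import Data.List.Relation.Unary.Unique.Propositional.Properties using (++⁺; filter⁺; cartesianProduct⁺)
open import Data.Nat using (ℕ; zero; suc; _<_; _≤_; z≤n; s≤s; _∸_; _^_; _+_; _*_; _!; NonZero; >-nonZero)
open import Data.Nat.Combinatorics using (_C_; nCk≡n!/k![n-k]!; nCk≡nC[n∸k]; nCn≡1; nC1≡n; k>n⇒nCk≡0; k![n∸k]!∣n!; nCk+nC[k+1]≡[n+1]C[k+1])
open import Data.Nat.DivMod using (m/n*n≡m)
open import Data.Nat.Properties as ℕₚ using (≤-antisym; ≤-trans; ≤-refl; ≤-reflexive; n≤1+n)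
import Data.Nat.Tactic.RingSolver as ℕ-Ring
open import Data.Product using (∃; ∃₂; _×_; _,_; proj₁; proj₂)
open import Data.Sum as Sum using (_⊎_; inj₁; inj₂)
open import Data.Vec using (tabulate)
import Data.Vec.Properties as Vecₚ
open import Function using (_∘_; case_of_)
open import Function.Bundles using (_⇔_; mk⇔; Equivalence)
open import Relation.Binary.Definitions using (DecidableEquality)
open import Relation.Binary.PropositionalEquality using (_≡_; _≢_; refl; sym; trans; cong; cong₂; subst; subst₂; module ≡-Reasoning)
open import Relation.Binary.Structures using (IsPartialOrder)
open import Relation.Nullary using (¬_; Dec; yes; no; does)
open import Relation.Nullary.Decidable using (decidable-stable; dec-true; ¬?; _×-dec_)
open import Relation.Unary using (Decidable)

private variable
  X Y : Set

-- Cardinalities of duplicate-free lists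

-- The head of `xs` occurs somewhere in `ys`; deleting that occurrence keeps the tail inside, since
-- no later entry equals the head.
length-mono : {xs ys : List X} → Unique xs → (∀ {x} → x ∈ xs → x ∈ ys) → length xs ≤ length ys
length-mono {xs = []} _ _ = z≤n
length-mono {xs = x ∷ xs} (x∉ ∷ uniq) sub with ∈-∃++ (sub (here refl))
... | as , bs , refl = ≤-trans (s≤s (length-mono uniq sub′)) (≤-reflexive lengths)
  where
  sub′ : ∀ {z} → z ∈ xs → z ∈ as ++ bs
  sub′ {z} z∈ with ∈-++⁻ as (sub (there z∈))
  ... | inj₁ p = ∈-++⁺ˡ p
  ... | inj₂ (here z≡x) = ⊥-elim (All.lookup x∉ z∈ (sym z≡x))
  ... | inj₂ (there p) = ∈-++⁺ʳ as p
  lengths : suc (length (as ++ bs)) ≡ length (as ++ x ∷ bs)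
  lengths = trans (cong suc (length-++ as))
    (trans (sym (ℕₚ.+-suc (length as) (length bs))) (sym (length-++ as)))

unique-map-on : (f : X → Y) {xs : List X} → Unique xs →
  (∀ {a b} → a ∈ xs → b ∈ xs → f a ≡ f b → a ≡ b) → Unique (map f xs)
unique-map-on f [] _ = []
unique-map-on f {x ∷ xs} (x∉ ∷ u) inj = All.tabulate fresh ∷ unique-map-on f u λ p q → inj (there p) (there q)
  where
  fresh : ∀ {w} → w ∈ map f xs → ¬ (f x ≡ w)
  fresh w∈ eq with ∈-map⁻ f w∈
  ... | v , v∈ , refl = All.lookup x∉ v∈ (inj (here refl) (there v∈) eq)

length-injection : {xs : List X} {ys : List Y} (f : X → Y) → Unique xs →
  (∀ {a} → a ∈ xs → f a ∈ ys) →
  (∀ {a b} → a ∈ xs → b ∈ xs → f a ≡ f b → a ≡ b) → length xs ≤ length ys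
length-injection {xs = xs} {ys = ys} f uniq into inj =
  subst (_≤ length ys) (length-map f xs) (length-mono (unique-map-on f uniq inj) sub)
  where
  sub : ∀ {b} → b ∈ map f xs → b ∈ ys
  sub b∈ with ∈-map⁻ f b∈
  ... | a , a∈ , refl = into a∈

length-bijection : {xs : List X} {ys : List Y} (f : X → Y) (g : Y → X) → Unique xs → Unique ys →
  (∀ {a} → a ∈ xs → f a ∈ ys) → (∀ {b} → b ∈ ys → g b ∈ xs) →
  (∀ {a} → a ∈ xs → g (f a) ≡ a) → (∀ {b} → b ∈ ys → f (g b) ≡ b) → length xs ≡ length ys
length-bijection f g uxs uys f∈ g∈ gf fg = ≤-antisym
  (length-injection f uxs f∈ λ p q eq → trans (sym (gf p)) (trans (cong g eq) (gf q)))
  (length-injection g uys g∈ λ p q eq → trans (sym (fg p)) (trans (cong f eq) (fg q)))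

-- A missing `y` could be put in front of `xs`, giving a duplicate-free list too long to fit in
-- `ys`. Later this identifies two sets of atoms, one inside the other, by their sizes.
mono-length-⊇ : DecidableEquality X → {xs ys : List X} → Unique xs →
  (∀ {x} → x ∈ xs → x ∈ ys) → length ys ≤ length xs → ∀ {y} → y ∈ ys → y ∈ xs
mono-length-⊇ _≟_ {xs} {ys} u sub le {y} y∈ = decidable-stable (y ∈? xs) λ y∉ →
  ℕₚ.<-irrefl refl (≤-trans (length-mono (All.tabulate (λ z∈ → λ { refl → y∉ z∈ }) ∷ u) sub′) le)
  where
  open import Data.List.Membership.DecPropositional _≟_ using (_∈?_)
  sub′ : ∀ {z} → z ∈ y ∷ xs → z ∈ ys
  sub′ (here refl) = y∈
  sub′ (there p) = sub p

lookup-injective : {xs : List X} → Unique xs → ∀ i j → lookup xs i ≡ lookup xs j → i ≡ j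
lookup-injective (_ ∷ _) zero zero _ = refl
lookup-injective (x∉ ∷ _) zero (suc j) e = ⊥-elim (All.lookup x∉ (∈-lookup j) e)
lookup-injective (x∉ ∷ _) (suc i) zero e = ⊥-elim (All.lookup x∉ (∈-lookup i) (sym e))
lookup-injective (_ ∷ u) (suc i) (suc j) e = cong suc (lookup-injective u i j e)

-- Locally finite and ranked posets

module LF (P : LFPoset) where
  open LFPoset P public renaming (_≤_ to _⊑_)
  open IsPartialOrder isPartialOrder public
    using () renaming (refl to ⊑-refl; trans to ⊑-trans; antisym to ⊑-antisym)
  _⊏_ _⋖′_ : Carrier → Carrier → Set
  _⊏_ = _<ₚ_ P
  _⋖′_ = _⋖_ P

  ∈-interval : ∀ {x y z} → x ⊑ z → z ⊑ y → z ∈ interval x y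
  ∈-interval p q = Equivalence.from (interval-mem _ _ _) (p , q)

  interval-bounds : ∀ {x y z} → z ∈ interval x y → x ⊑ z × z ⊑ y
  interval-bounds = Equivalence.to (interval-mem _ _ _)

  infix 4 _⊑?_ _≟_
  -- x ≤ y exactly when the listed interval is nonempty.
  _⊑?_ : ∀ x y → Dec (x ⊑ y)
  x ⊑? y with interval x y in eq
  ... | [] = no λ p → ⊥-elim (case-[] (subst (x ∈_) eq (∈-interval ⊑-refl p)))
    where
    case-[] : ¬ (x ∈ [])
    case-[] ()
  ... | z ∷ _ = let p , q = interval-bounds (subst (z ∈_) (sym eq) (here refl)) in yes (⊑-trans p q)

  _≟_ : DecidableEquality Carrier
  x ≟ y with x ⊑? y | y ⊑? x
  ... | yes p | yes q = yes (⊑-antisym p q)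
  ... | no p | _ = no λ { refl → p ⊑-refl }
  ... | yes _ | no q = no λ { refl → q ⊑-refl }

  size : Carrier → Carrier → ℕ
  size x y = length (interval x y)

  size-<ˡ : ∀ {x y z} → x ⊑ z → z ⊏ y → size x z < size x y
  size-<ˡ {x} {y} {z} xz (zy , z≢y) = length-mono
    (All.tabulate (λ w∈ → λ { refl → z≢y (⊑-antisym zy (proj₂ (interval-bounds w∈))) }) ∷ interval-uniq x z)
    λ { (here refl) → ∈-interval (⊑-trans xz zy) ⊑-refl
      ; (there w∈) → let p , q = interval-bounds w∈ in ∈-interval p (⊑-trans q zy) }

  size-<ʳ : ∀ {x y z} → x ⊏ z → z ⊑ y → size z y < size x y
  size-<ʳ {x} {y} {z} (xz , x≢z) zy = length-mono
    (All.tabulate (λ w∈ → λ { refl → x≢z (⊑-antisym xz (proj₁ (interval-bounds w∈))) }) ∷ interval-uniq z y)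
    λ { (here refl) → ∈-interval ⊑-refl (⊑-trans xz zy)
      ; (there w∈) → let p , q = interval-bounds w∈ in ∈-interval (⊑-trans xz p) q }

  -- An element strictly between `x` and `y` can replace `y` and shrinks the interval; when there is
  -- none, `y` itself covers `x`. In `go`, the bound `n` on the size drives the recursion.
  cover-below : ∀ {x y} → x ⊏ y → ∃ λ a → x ⋖′ a × a ⊑ y
  cover-below {x} {y} = go (size x y) ≤-refl
    where
    go : ∀ n {y} → size x y ≤ n → x ⊏ y → ∃ λ a → x ⋖′ a × a ⊑ y
    go zero {y} le (xy , _) = ⊥-elim (ℕₚ.n≮0 (≤-trans (∈-length (∈-interval xy ⊑-refl)) le))
    go (suc n) {y} le (xy , x≢y) with Any.any? (λ z → ¬? (z ≟ x) ×-dec ¬? (z ≟ y)) (interval x y)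
    ... | yes found =
      let z , z∈ , z≢x , z≢y = find found
          xz , zy = interval-bounds z∈
          a , cov , az = go n (ℕₚ.≤-pred (≤-trans (size-<ˡ xz (zy , z≢y)) le)) (xz , λ e → z≢x (sym e))
      in a , cov , ⊑-trans az zy
    ... | no none = y , ((xy , x≢y) , λ z xz zy → only z (∈-interval xz zy)) , ⊑-refl
      where
      only : ∀ z → z ∈ interval x y → (z ≡ x) ⊎ (z ≡ y)
      only z z∈ with z ≟ x | z ≟ y
      ... | yes e | _ = inj₁ e
      ... | no _ | yes e = inj₂ e
      ... | no p | no q = ⊥-elim (none (lose z∈ (p , q)))

  maxChain-exists : ∀ {x y} → x ⊑ y → ∃ (MaxChain P x y)
  maxChain-exists {x} {y} = go (size x y) ≤-refl
    where
    go : ∀ n {x} → size x y ≤ n → x ⊑ y → ∃ (MaxChain P x y)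
    go n {x} le xy with x ≟ y
    ... | yes refl = _ , single x
    go zero le xy | no _ = ⊥-elim (ℕₚ.n≮0 (≤-trans (∈-length (∈-interval xy ⊑-refl)) le))
    go (suc n) le xy | no x≢y =
      let a , cov , ay = cover-below (xy , x≢y)
          c , mc = go n (ℕₚ.≤-pred (≤-trans (size-<ʳ (proj₁ cov) ay) le)) ay
      in _ , step cov mc

  maxChain-⊑ : ∀ {x y c} → MaxChain P x y c → x ⊑ y
  maxChain-⊑ (single _) = ⊑-refl
  maxChain-⊑ (step ((xa , _) , _) mc) = ⊑-trans xa (maxChain-⊑ mc)

  maxChain-head : ∀ {x y c} → MaxChain P x y c → ∃ λ cs → c ≡ x ∷ cs
  maxChain-head (single _) = _ , refl
  maxChain-head (step _ _) = _ , refl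

module Ranked (P : LFPoset) (ρ : LFPoset.Carrier P → ℕ) (isRank : IsRankFunction P ρ) where
  open LF P public

  ρ-cover : ∀ {x y} → x ⋖′ y → ρ y ≡ suc (ρ x)
  ρ-cover = proj₂ isRank _ _

  maxChain-ρ : ∀ {x y c} → MaxChain P x y c → ρ x ≤ ρ y
  maxChain-ρ (single _) = ≤-refl
  maxChain-ρ (step cov mc) = ≤-trans (ℕₚ.<⇒≤ (≤-reflexive (sym (ρ-cover cov)))) (maxChain-ρ mc)

  ρ-mono : ∀ {x y} → x ⊑ y → ρ x ≤ ρ y
  ρ-mono xy = maxChain-ρ (proj₂ (maxChain-exists xy))

  ρ-strict : ∀ {x y} → x ⊏ y → ρ x < ρ y
  ρ-strict xy = let a , cov , ay = cover-below xy in
    ≤-trans (≤-reflexive (sym (ρ-cover cov))) (ρ-mono ay)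

  ρ-injective : ∀ {x y} → x ⊑ y → ρ y ≤ ρ x → x ≡ y
  ρ-injective {x} {y} xy le = decidable-stable (x ≟ y) λ x≢y → ℕₚ.<⇒≱ (ρ-strict (xy , x≢y)) le

  -- The element `z` ends one half and begins the other, so `take (suc r)` and `drop r` overlap in
  -- one entry; `maxChain-glue` drops the repetition.
  maxChain-split : ∀ r {x y c} → MaxChain P x y c → r + ρ x ≤ ρ y →
    ∃ λ z → ρ z ≡ r + ρ x × MaxChain P x z (take (suc r) c) × MaxChain P z y (drop r c)
  maxChain-split zero {x} mc@(single _) _ = x , refl , single x , mc
  maxChain-split zero {x} mc@(step _ _) _ = x , refl , single x , mc
  maxChain-split (suc r) (single x) le = ⊥-elim (ℕₚ.m+n≮n r (ρ x) le)
  maxChain-split (suc r) {x} {y} (step {y = a} cov mc) le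
    with maxChain-split r mc (subst (_≤ ρ y) (sym shift) le)
    where
    shift : r + ρ a ≡ suc r + ρ x
    shift = trans (cong (λ t → r + t) (ρ-cover cov)) (ℕₚ.+-suc r (ρ x))
  ... | z , ρz , mc₁ , mc₂ =
    z , trans ρz (trans (cong (λ t → r + t) (ρ-cover cov)) (ℕₚ.+-suc r (ρ x))) , step cov mc₁ , mc₂

  between-rank : ∀ r {x y} → x ⊑ y → r + ρ x ≤ ρ y → ∃ λ z → x ⊑ z × z ⊑ y × ρ z ≡ r + ρ x
  between-rank r xy le with maxChain-split r (proj₂ (maxChain-exists xy)) le
  ... | z , ρz , mc₁ , mc₂ = z , maxChain-⊑ mc₁ , maxChain-⊑ mc₂ , ρz

  maxChain-glue : ∀ {x y z c d} → MaxChain P x z c → MaxChain P z y d → MaxChain P x y (c ++ drop 1 d)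
  maxChain-glue (single _) (single y) = single y
  maxChain-glue (single _) (step cov mc) = step cov mc
  maxChain-glue (step cov mc) mc′ = step cov (maxChain-glue mc mc′)

  -- Ranks rise by one along a chain, so `c` has exactly `suc r` entries and the cut falls at its
  -- end.
  glue-split : ∀ r {x y z c d} → MaxChain P x z c → MaxChain P z y d → ρ z ≡ r + ρ x →
    take (suc r) (c ++ drop 1 d) ≡ c × drop r (c ++ drop 1 d) ≡ d
  glue-split zero (single x) (single _) _ = refl , refl
  glue-split zero (single x) (step _ _) _ = refl , refl
  glue-split (suc r) (single x) _ eq = ⊥-elim (ℕₚ.m≢1+n+m (ρ x) eq)
  glue-split zero {x} (step cov mc) _ eq =
    ⊥-elim (ℕₚ.<⇒≢ (ρ-strict (⊑-trans (proj₁ (proj₁ cov)) (maxChain-⊑ mc) ,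
      λ { refl → ℕₚ.<⇒≱ (≤-reflexive (sym (ρ-cover cov))) (maxChain-ρ mc) })) (sym eq))
  glue-split (suc r) {x} (step {y = a} cov mc) mc′ eq =
    let p , q = glue-split r mc mc′ (trans eq (sym (trans (cong (λ t → r + t) (ρ-cover cov)) (ℕₚ.+-suc r (ρ x)))))
    in cong (x ∷_) p , q

  elems : ℕ → Carrier → Carrier → List Carrier
  elems r x y = filter (λ z → ρ z ℕₚ.≟ r + ρ x) (interval x y)

  elems-unique : ∀ r x y → Unique (elems r x y)
  elems-unique r x y = filter⁺ (λ z → ρ z ℕₚ.≟ r + ρ x) (interval-uniq x y)

  ∈-elems : ∀ {r x y z} → x ⊑ z → z ⊑ y → ρ z ≡ r + ρ x → z ∈ elems r x y
  ∈-elems {r} {x} p q e = ∈-filter⁺ (λ z → ρ z ℕₚ.≟ r + ρ x) (∈-interval p q) e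

  elems-∈ : ∀ {r x y z} → z ∈ elems r x y → x ⊑ z × z ⊑ y × ρ z ≡ r + ρ x
  elems-∈ {r} {x} {y} z∈ with ∈-filter⁻ (λ z → ρ z ℕₚ.≟ r + ρ x) {xs = interval x y} z∈
  ... | z∈′ , e = let p , q = interval-bounds z∈′ in p , q , e

-- Euler relations and Whitney numbers

length-cartesianProduct : (xs : List X) (ys : List Y) →
  length (cartesianProduct xs ys) ≡ length xs * length ys
length-cartesianProduct [] ys = refl
length-cartesianProduct (x ∷ xs) ys = trans (length-++ (map (x ,_) ys))
  (cong₂ _+_ (length-map (x ,_) ys) (length-cartesianProduct xs ys))

sign : ℕ → ℤ
sign k = -1ℤ ℤ.^ k

sumTo : ℕ → (ℕ → ℤ) → ℤ
sumTo zero f = f 0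
sumTo (suc n) f = sumTo n f ℤ.+ f (suc n)

sumTo-cong : ∀ n {f g} → (∀ k → k ≤ n → f k ≡ g k) → sumTo n f ≡ sumTo n g
sumTo-cong zero eq = eq 0 z≤n
sumTo-cong (suc n) eq = cong₂ ℤ._+_ (sumTo-cong n λ k k≤ → eq k (≤-trans k≤ (n≤1+n n))) (eq (suc n) ≤-refl)

sumTo-zero : ∀ n {f} → (∀ k → k ≤ n → f k ≡ 0ℤ) → sumTo n f ≡ 0ℤ
sumTo-zero zero eq = eq 0 z≤n
sumTo-zero (suc n) eq = cong₂ ℤ._+_ (sumTo-zero n λ k k≤ → eq k (≤-trans k≤ (n≤1+n n))) (eq (suc n) ≤-refl)

-- Adding one element to a list changes a single rank count; this is the induction step of
-- `sum-by-rank`.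
sumTo-update : ∀ n {f g} j d → j ≤ n → f j ≡ d ℤ.+ g j → (∀ k → k ≢ j → f k ≡ g k) →
  sumTo n f ≡ d ℤ.+ sumTo n g
sumTo-update zero .0 d z≤n at off = at
sumTo-update (suc n) {f} {g} j d j≤ at off with j ℕₚ.≟ suc n
... | yes refl = begin
  sumTo n f ℤ.+ f (suc n)
    ≡⟨ cong₂ ℤ._+_ (sumTo-cong n λ k k≤ → off k (ℕₚ.<⇒≢ (s≤s k≤))) (trans at (ℤₚ.+-comm d _)) ⟩
  sumTo n g ℤ.+ (g (suc n) ℤ.+ d) ≡⟨ sym (ℤₚ.+-assoc (sumTo n g) _ _) ⟩
  sumTo n g ℤ.+ g (suc n) ℤ.+ d   ≡⟨ ℤₚ.+-comm _ d ⟩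
  d ℤ.+ (sumTo n g ℤ.+ g (suc n)) ∎
  where open ≡-Reasoning
... | no j≢ = trans
  (cong₂ ℤ._+_ (sumTo-update n j d (ℕₚ.≤-pred (ℕₚ.≤∧≢⇒< j≤ j≢)) at off) (off (suc n) (j≢ ∘ sym)))
  (ℤₚ.+-assoc d _ _)

-- The bounds make the truncated subtraction exact and put every rank within the range of the sum.
sum-by-rank : (ρ : X → ℕ) (h : ℕ → ℤ) (c n : ℕ) (L : List X) → All (λ z → c ≤ ρ z × ρ z ≤ n + c) L →
  sumℤ (map (λ z → h (ρ z ∸ c)) L) ≡
  sumTo n (λ k → + length (filter (λ z → ρ z ℕₚ.≟ k + c) L) ℤ.* h k)
sum-by-rank ρ h c n [] [] = sym (sumTo-zero n λ k _ → ℤₚ.*-zeroˡ (h k))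
sum-by-rank {X} ρ h c n (z ∷ L) ((c≤ , ≤n) ∷ rest) =
  trans (cong (λ s → h j ℤ.+ s) (sum-by-rank ρ h c n L rest))
    (sym (sumTo-update n j (h j) j≤n at off))
  where
  j = ρ z ∸ c
  j+c : j + c ≡ ρ z
  j+c = ℕₚ.m∸n+n≡m c≤
  j≤n : j ≤ n
  j≤n = subst (j ≤_) (ℕₚ.m+n∸n≡m n c) (ℕₚ.∸-monoˡ-≤ c ≤n)
  key? : ∀ k (w : X) → Dec (ρ w ≡ k + c)
  key? k w = ρ w ℕₚ.≟ k + c
  at : + length (filter (key? j) (z ∷ L)) ℤ.* h j ≡ h j ℤ.+ + length (filter (key? j) L) ℤ.* h j
  at = trans (cong (λ l → + length l ℤ.* h j) (filter-accept (key? j) {xs = L} (sym j+c)))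
    (ℤₚ.suc-* (+ length (filter (key? j) L)) (h j))
  off : ∀ k → k ≢ j → + length (filter (key? k) (z ∷ L)) ℤ.* h k ≡ + length (filter (key? k) L) ℤ.* h k
  off k k≢j = cong (λ l → + length l ℤ.* h k)
    (filter-reject (key? k) {xs = L} λ e → k≢j (ℕₚ.+-cancelʳ-≡ c k j (trans (sym e) (sym j+c))))

sum-remove : (_≟_ : DecidableEquality X) (f : X → ℤ) {y : X} {L : List X} → Unique L → y ∈ L →
  sumℤ (map f L) ≡ f y ℤ.+ sumℤ (map f (filter (λ z → ¬? (z ≟ y)) L))
sum-remove _≟_ f {y} {z ∷ L} (z∉ ∷ u) (here refl) = cong (λ l → f z ℤ.+ sumℤ (map f l))
  (trans (sym (filter-all (λ w → ¬? (w ≟ z)) (All.map (_∘ sym) z∉)))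
    (sym (filter-reject (λ w → ¬? (w ≟ z)) {xs = L} λ z≢z → z≢z refl)))
sum-remove _≟_ f {y} {z ∷ L} (z∉ ∷ u) (there y∈) = begin
  f z ℤ.+ sumℤ (map f L)          ≡⟨ cong (λ s → f z ℤ.+ s) (sum-remove _≟_ f u y∈) ⟩
  f z ℤ.+ (f y ℤ.+ rest)          ≡⟨ sym (ℤₚ.+-assoc (f z) (f y) rest) ⟩
  f z ℤ.+ f y ℤ.+ rest            ≡⟨ cong (λ s → s ℤ.+ rest) (ℤₚ.+-comm (f z) (f y)) ⟩
  f y ℤ.+ f z ℤ.+ rest            ≡⟨ ℤₚ.+-assoc (f y) (f z) rest ⟩
  f y ℤ.+ (f z ℤ.+ rest)
    ≡⟨ cong (λ l → f y ℤ.+ sumℤ (map f l)) (sym (filter-accept (λ w → ¬? (w ≟ y)) {xs = L} (All.lookup z∉ y∈))) ⟩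
  f y ℤ.+ sumℤ (map f (filter (λ w → ¬? (w ≟ y)) (z ∷ L))) ∎
  where
  open ≡-Reasoning
  rest = sumℤ (map f (filter (λ w → ¬? (w ≟ y)) L))

-- Construction of the Möbius function and the Euler relation

module Möbius (P : LFPoset) (ρ : LFPoset.Carrier P → ℕ) (isRank : IsRankFunction P ρ) where
  open Ranked P ρ isRank

  halfOpen : Carrier → Carrier → List Carrier
  halfOpen x y = filter (λ z → ¬? (z ≟ y)) (interval x y)

  -- Meaningful for ρ y < k only; the value at k = 0 is junk.
  μ-below : ℕ → Carrier → Carrier → ℤ
  μ-below zero x y = 1ℤ
  μ-below (suc k) x y with x ≟ y
  ... | yes _ = 1ℤ
  ... | no _ = ℤ.- sumℤ (map (μ-below k x) (halfOpen x y))

  halfOpen-rank : ∀ {x y} → All (λ z → ρ z < ρ y) (halfOpen x y)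
  halfOpen-rank {x} {y} = All.tabulate λ z∈ →
    let z∈′ , z≢y = ∈-filter⁻ (λ z → ¬? (z ≟ y)) {xs = interval x y} z∈
    in ρ-strict (proj₂ (interval-bounds z∈′) , z≢y)

  -- Recursive calls go to elements of smaller rank, so any fuel above the rank of `y` gives the
  -- same value.
  μ-below-stable : ∀ k l x {y} → ρ y < k → ρ y < l → μ-below k x y ≡ μ-below l x y
  μ-below-stable (suc k) (suc l) x {y} (s≤s yk) (s≤s yl) with x ≟ y
  ... | yes _ = refl
  ... | no _ = cong (λ s → ℤ.- sumℤ s) (map-cong-local
    (All.map (λ zy → μ-below-stable k l x (≤-trans zy yk) (≤-trans zy yl)) halfOpen-rank))

  μ : Carrier → Carrier → ℤ
  μ x y = μ-below (suc (ρ y)) x y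

  -- `IsEulerian` speaks of functions satisfying `IsMobius`, so one must be exhibited before that
  -- hypothesis yields anything.
  μ-isMobius : IsMobius P μ
  μ-isMobius = diag , off
    where
    diag : ∀ x → μ x x ≡ 1ℤ
    diag x with x ≟ x
    ... | yes _ = refl
    ... | no x≢x = ⊥-elim (x≢x refl)
    recur : ∀ x y → x ≢ y → μ x y ≡ ℤ.- sumℤ (map (μ-below (ρ y) x) (halfOpen x y))
    recur x y x≢y with x ≟ y
    ... | yes e = ⊥-elim (x≢y e)
    ... | no _ = refl
    off : ∀ x y → x ⊏ y → sumℤ (map (μ x) (interval x y)) ≡ 0ℤ
    off x y (xy , x≢y) = begin
      sumℤ (map (μ x) (interval x y))
        ≡⟨ sum-remove _≟_ (μ x) (interval-uniq x y) (∈-interval xy ⊑-refl) ⟩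
      μ x y ℤ.+ sumℤ (map (μ x) (halfOpen x y))
        ≡⟨ cong₂ ℤ._+_ (recur x y x≢y) (cong sumℤ (map-cong-local
             (All.map (λ zy → μ-below-stable _ (ρ y) x ≤-refl zy) halfOpen-rank))) ⟩
      ℤ.- rest ℤ.+ rest ≡⟨ ℤₚ.+-inverseˡ rest ⟩
      0ℤ ∎
      where
      open ≡-Reasoning
      rest = sumℤ (map (μ-below (ρ y) x) (halfOpen x y))

  -- The values `μ x z` over the interval sum to zero, and each is the sign of the relative rank of
  -- `z`; grouping by rank leaves an alternating sum.
  euler-relation : IsEulerian P ρ → ∀ {n x y} → x ⊑ y → ρ y ≡ suc n + ρ x →
    sumTo (suc n) (λ k → + length (elems k x y) ℤ.* sign k) ≡ 0ℤ
  euler-relation eul {n} {x} {y} xy ρy = begin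
    sumTo (suc n) (λ k → + length (elems k x y) ℤ.* sign k)
      ≡⟨ sym (sum-by-rank ρ sign (ρ x) (suc n) (interval x y) (All.tabulate λ z∈ →
           let p , q = interval-bounds z∈ in ρ-mono p , ≤-trans (ρ-mono q) (≤-reflexive ρy))) ⟩
    sumℤ (map (λ z → sign (ρ z ∸ ρ x)) (interval x y))
      ≡⟨ cong sumℤ (sym (map-cong-local (All.tabulate λ z∈ →
           eul μ μ-isMobius x _ (proj₁ (interval-bounds z∈))))) ⟩
    sumℤ (map (μ x) (interval x y))
      ≡⟨ proj₂ μ-isMobius x y (xy , λ { refl → ℕₚ.m≢1+n+m (ρ x) ρy }) ⟩
    0ℤ ∎
    where open ≡-Reasoning

-- Counting maximal chains through a fixed rank

module Binomial (P : LFPoset) (ρ : LFPoset.Carrier P → ℕ) (isRank : IsRankFunction P ρ)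
  (B : ℕ → ℕ) (fact : IsFactorialFunction P ρ B) where
  open Ranked P ρ isRank public

  IsInterval : ℕ → Carrier → Carrier → Set
  IsInterval n x y = x ⊑ y × ρ y ≡ n + ρ x

  numChains : ∀ {x y} → x ⊑ y → NumMaxChains P x y (B (ρ y ∸ ρ x))
  numChains xy = fact _ _ _ xy (sym (ℕₚ.m∸n+n≡m (ρ-mono xy)))

  -- Total in `x` and `y`, so that lists over many intermediate elements can be formed without
  -- carrying order proofs.
  chains : Carrier → Carrier → List (List Carrier)
  chains x y with x ⊑? y
  ... | yes xy = proj₁ (numChains xy)
  ... | no _ = []

  chains-unique : ∀ x y → Unique (chains x y)
  chains-unique x y with x ⊑? y
  ... | yes xy = proj₁ (proj₂ (proj₂ (numChains xy)))
  ... | no _ = []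

  chains-sound : ∀ {x y c} → c ∈ chains x y → MaxChain P x y c
  chains-sound {x} {y} {c} c∈ with x ⊑? y
  ... | yes xy = Equivalence.to (proj₂ (proj₂ (proj₂ (numChains xy))) c) c∈

  chains-complete : ∀ {x y c} → MaxChain P x y c → c ∈ chains x y
  chains-complete {x} {y} {c} mc with x ⊑? y
  ... | yes xy = Equivalence.from (proj₂ (proj₂ (proj₂ (numChains xy))) c) mc
  ... | no ¬xy = ⊥-elim (¬xy (maxChain-⊑ mc))

  chains-length : ∀ {n x y} → IsInterval n x y → length (chains x y) ≡ B n
  chains-length {n} {x} {y} (xy , ρy) with x ⊑? y
  ... | yes xy′ = trans (proj₁ (proj₂ (numChains xy′)))
    (cong B (trans (cong (_∸ ρ x) ρy) (ℕₚ.m+n∸n≡m n (ρ x))))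
  ... | no ¬xy = ⊥-elim (¬xy xy)

  splitChains : Carrier → Carrier → List Carrier → List (List Carrier × List Carrier)
  splitChains x y [] = []
  splitChains x y (z ∷ zs) = cartesianProduct (chains x z) (chains z y) ++ splitChains x y zs

  splitChains-∈ : ∀ {x y} zs {c d} → (c , d) ∈ splitChains x y zs →
    ∃ λ z → z ∈ zs × MaxChain P x z c × MaxChain P z y d
  splitChains-∈ {x} {y} (z ∷ zs) p with ∈-++⁻ (cartesianProduct (chains x z) (chains z y)) p
  ... | inj₁ q = let c∈ , d∈ = ∈-cartesianProduct⁻ (chains x z) (chains z y) q in
    z , here refl , chains-sound c∈ , chains-sound d∈
  ... | inj₂ q = let w , w∈ , mc , mc′ = splitChains-∈ zs q in w , there w∈ , mc , mc′

  ∈-splitChains : ∀ {x y zs z c d} → z ∈ zs → MaxChain P x z c → MaxChain P z y d →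
    (c , d) ∈ splitChains x y zs
  ∈-splitChains (here refl) mc mc′ =
    ∈-++⁺ˡ (∈-cartesianProduct⁺ (chains-complete mc) (chains-complete mc′))
  ∈-splitChains {x} {y} {w ∷ _} (there z∈) mc mc′ =
    ∈-++⁺ʳ (cartesianProduct (chains x w) (chains w y)) (∈-splitChains z∈ mc mc′)

  maxChain-start : ∀ {x x′ y c} → MaxChain P x y c → MaxChain P x′ y c → x ≡ x′
  maxChain-start mc mc′ with maxChain-head mc | maxChain-head mc′
  ... | _ , refl | _ , refl = refl

  -- The second chain of a pair starts at `z`, so the blocks belonging to different `z` are
  -- disjoint.
  splitChains-unique : ∀ x y {zs} → Unique zs → Unique (splitChains x y zs)
  splitChains-unique x y [] = []
  splitChains-unique x y {z ∷ zs} (z∉ ∷ u) =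
    ++⁺ (cartesianProduct⁺ (chains-unique x z) (chains-unique z y)) (splitChains-unique x y u)
      λ { {c , d} (p , q) →
        let _ , d∈ = ∈-cartesianProduct⁻ (chains x z) (chains z y) p
            w , w∈ , _ , mc = splitChains-∈ zs q
        in All.lookup z∉ w∈ (maxChain-start (chains-sound d∈) mc) }

  splitChains-length : ∀ {r s x y} zs → All (λ z → IsInterval r x z × IsInterval s z y) zs →
    length (splitChains x y zs) ≡ length zs * (B r * B s)
  splitChains-length [] [] = refl
  splitChains-length {r} {s} {x} {y} (z ∷ zs) ((i , j) ∷ rest) = begin
    length (cartesianProduct (chains x z) (chains z y) ++ splitChains x y zs)
      ≡⟨ length-++ (cartesianProduct (chains x z) (chains z y)) ⟩
    length (cartesianProduct (chains x z) (chains z y)) + length (splitChains x y zs)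
      ≡⟨ cong₂ _+_ (length-cartesianProduct (chains x z) (chains z y)) (splitChains-length zs rest) ⟩
    length (chains x z) * length (chains z y) + length zs * (B r * B s)
      ≡⟨ cong (λ t → t + length zs * (B r * B s)) (cong₂ _*_ (chains-length i) (chains-length j)) ⟩
    B r * B s + length zs * (B r * B s) ∎
    where open ≡-Reasoning

  elems-interval : ∀ r s {x y z} → ρ y ≡ r + s + ρ x → z ∈ elems r x y → IsInterval r x z × IsInterval s z y
  elems-interval r s {x} {y} {z} ρy z∈ = let p , q , ρz = elems-∈ z∈ in (p , ρz) , q , (begin
    ρ y           ≡⟨ ρy ⟩
    r + s + ρ x   ≡⟨ cong (λ t → t + ρ x) (ℕₚ.+-comm r s) ⟩
    s + r + ρ x   ≡⟨ ℕₚ.+-assoc s r (ρ x) ⟩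
    s + (r + ρ x) ≡⟨ cong (λ t → s + t) (sym ρz) ⟩
    s + ρ z       ∎)
    where open ≡-Reasoning

  -- Cutting at the element of rank `r` is a bijection from maximal chains onto pairs of chains
  -- meeting there, and each such element contributes `B r * B s` pairs.
  count : ∀ r s {x y} → IsInterval (r + s) x y → B (r + s) ≡ length (elems r x y) * (B r * B s)
  count r s {x} {y} (xy , ρy) = begin
    B (r + s)              ≡⟨ sym (chains-length (xy , ρy)) ⟩
    length (chains x y)
      ≡⟨ length-bijection split glue (chains-unique x y) (splitChains-unique x y (elems-unique r x y))
           split-∈ glue-∈ (λ {c} _ → glue-of-split c) split-of-glue ⟩
    length (splitChains x y (elems r x y))
      ≡⟨ splitChains-length (elems r x y) (All.tabulate (elems-interval r s ρy)) ⟩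
    length (elems r x y) * (B r * B s) ∎
    where
    open ≡-Reasoning
    split : List Carrier → List Carrier × List Carrier
    split c = take (suc r) c , drop r c
    glue : List Carrier × List Carrier → List Carrier
    glue (c , d) = c ++ drop 1 d
    split-∈ : ∀ {c} → c ∈ chains x y → split c ∈ splitChains x y (elems r x y)
    split-∈ c∈ =
      let z , ρz , mc , mc′ = maxChain-split r (chains-sound c∈)
            (≤-trans (ℕₚ.+-monoˡ-≤ (ρ x) (ℕₚ.m≤m+n r s)) (≤-reflexive (sym ρy)))
      in ∈-splitChains (∈-elems {r} (maxChain-⊑ mc) (maxChain-⊑ mc′) ρz) mc mc′
    glue-∈ : ∀ {p} → p ∈ splitChains x y (elems r x y) → glue p ∈ chains x y
    glue-∈ p∈ = let z , _ , mc , mc′ = splitChains-∈ (elems r x y) p∈ in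
      chains-complete (maxChain-glue mc mc′)
    glue-of-split : ∀ c → glue (split c) ≡ c
    glue-of-split c = trans (cong (take (suc r) c ++_)
      (trans (drop-drop r 1 c) (cong (λ k → drop k c) (ℕₚ.+-comm r 1)))) (take++drop≡id (suc r) c)
    split-of-glue : ∀ {p} → p ∈ splitChains x y (elems r x y) → split (glue p) ≡ p
    split-of-glue p∈ =
      let z , z∈ , mc , mc′ = splitChains-∈ (elems r x y) p∈
          e , e′ = glue-split r mc mc′ (proj₂ (proj₂ (elems-∈ {r} z∈)))
      in cong₂ _,_ e e′

-- Arithmetic of factorial functions

double : ℕ → ℕ
double zero = 0
double (suc i) = suc (suc (double i))

sign-double : ∀ i → sign (double i) ≡ 1ℤ
sign-double zero = refl
sign-double (suc i) = cong (λ s → -1ℤ ℤ.* (-1ℤ ℤ.* s)) (sign-double i)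

sumTo-sign-double : ∀ i → sumTo (double i) sign ≡ 1ℤ
sumTo-sign-double zero = refl
sumTo-sign-double (suc i) rewrite sign-double i | sumTo-sign-double i = refl

sumTo-linear : ∀ n a b (f g : ℕ → ℤ) →
  sumTo n (λ k → a ℤ.* f k ℤ.- b ℤ.* g k) ≡ a ℤ.* sumTo n f ℤ.- b ℤ.* sumTo n g
sumTo-linear zero a b f g = refl
sumTo-linear (suc n) a b f g = trans
  (cong (λ s → s ℤ.+ (a ℤ.* f (suc n) ℤ.- b ℤ.* g (suc n))) (sumTo-linear n a b f g))
  (regroup a b (sumTo n f) (sumTo n g) (f (suc n)) (g (suc n)))
  where
  regroup : ∀ a b s t x y → (a ℤ.* s ℤ.- b ℤ.* t) ℤ.+ (a ℤ.* x ℤ.- b ℤ.* y)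
    ≡ a ℤ.* (s ℤ.+ x) ℤ.- b ℤ.* (t ℤ.+ y)
  regroup = ℤ-Ring.solve-∀

sumTo-ends : ∀ j (f : ℕ → ℤ) → (∀ k → k ≤ j → f (2 + k) ≡ 0ℤ) →
  sumTo (4 + j) f ≡ f 0 ℤ.+ f 1 ℤ.+ f (3 + j) ℤ.+ f (4 + j)
sumTo-ends j f middle = cong (λ s → s ℤ.+ f (3 + j) ℤ.+ f (4 + j)) (start j middle)
  where
  start : ∀ j → (∀ k → k ≤ j → f (2 + k) ≡ 0ℤ) → sumTo (2 + j) f ≡ f 0 ℤ.+ f 1
  start zero middle = trans (cong (λ s → f 0 ℤ.+ f 1 ℤ.+ s) (middle 0 ≤-refl)) (ℤₚ.+-identityʳ _)
  start (suc j) middle = trans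
    (cong₂ ℤ._+_ (start j λ k k≤ → middle k (≤-trans k≤ (n≤1+n j))) (middle (suc j) ≤-refl))
    (ℤₚ.+-identityʳ _)

-- By Pascal's rule each new term combines with the previous partial sum into a single binomial
-- coefficient.
C-partial-alternating : ∀ n j → sumTo j (λ k → + (suc n C k) ℤ.* sign k) ≡ + (n C j) ℤ.* sign j
C-partial-alternating n zero = cong (λ c → + c ℤ.* 1ℤ) (trans (C0 (suc n)) (sym (C0 n)))
  where
  C0 : ∀ n → n C 0 ≡ 1
  C0 n = trans (nCk≡nC[n∸k] {0} {n} z≤n) (nCn≡1 n)
C-partial-alternating n (suc j) = begin
  sumTo j (λ k → + (suc n C k) ℤ.* sign k) ℤ.+ + (suc n C suc j) ℤ.* (-1ℤ ℤ.* sign j)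
    ≡⟨ cong₂ (λ s c → s ℤ.+ c ℤ.* (-1ℤ ℤ.* sign j)) (C-partial-alternating n j)
         (trans (cong +_ (sym (nCk+nC[k+1]≡[n+1]C[k+1] n j))) (ℤₚ.pos-+ (n C j) (n C suc j))) ⟩
  + (n C j) ℤ.* sign j ℤ.+ (+ (n C j) ℤ.+ + (n C suc j)) ℤ.* (-1ℤ ℤ.* sign j)
    ≡⟨ telescope (+ (n C j)) (+ (n C suc j)) (sign j) ⟩
  + (n C suc j) ℤ.* (-1ℤ ℤ.* sign j) ∎
  where
  open ≡-Reasoning
  telescope : ∀ a b s → a ℤ.* s ℤ.+ (a ℤ.+ b) ℤ.* (-1ℤ ℤ.* s) ≡ b ℤ.* (-1ℤ ℤ.* s)
  telescope = ℤ-Ring.solve-∀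

C-alternating : ∀ n → sumTo (suc n) (λ k → + (suc n C k) ℤ.* sign k) ≡ 0ℤ
C-alternating n = trans (C-partial-alternating n (suc n))
  (trans (cong (λ c → + c ℤ.* sign (suc n)) (k>n⇒nCk≡0 {n} {suc n} ≤-refl)) (ℤₚ.*-zeroˡ (sign (suc n))))

C-factorials : ∀ r s → ((r + s) C r) * (r ! * s !) ≡ (r + s) !
C-factorials r s = subst (λ t → ((r + s) C r) * (r ! * t !) ≡ (r + s) !) (ℕₚ.m+n∸m≡n r s)
  (trans (cong (_* (r ! * (r + s ∸ r) !)) (nCk≡n!/k![n-k]! (ℕₚ.m≤m+n r s)))
    (m/n*n≡m {{_}} (k![n∸k]!∣n! (ℕₚ.m≤m+n r s))))

shift-middle : ∀ a b {n} → a + b ≡ n → (2 + a) + (2 + b) ≡ 4 + n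
shift-middle a b a+b = trans (solved a b) (cong (λ t → 4 + t) a+b)
  where
  solved : ∀ a b → (2 + a) + (2 + b) ≡ 4 + (a + b)
  solved = ℕ-Ring.solve-∀

-- Classification of the possible factorial functions

module Numerics (B : ℕ → ℕ) (W : ℕ → ℕ → ℕ) (B-pos : ∀ n → 0 < B n) (B1 : B 1 ≡ 1)
  (split : ∀ r s {n} → r + s ≡ n → B n ≡ W n r * (B r * B s))
  (euler : ∀ n → sumTo (suc n) (λ k → + W (suc n) k ℤ.* sign k) ≡ 0ℤ)
  (mono : ∀ n → W (suc n) 1 ≤ W (suc (suc n)) 1)
  (no-three : ∀ n → W 2 1 ≡ 2 → W 3 1 ≡ 2 → W (3 + n) 1 ≡ 2 → W (4 + n) 1 ≢ 3)
  where

  A : ℕ → ℕ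
  A n = W n 1

  instance
    B-nonZero : ∀ {n} → NonZero (B n)
    B-nonZero = >-nonZero (B-pos _)

  -- The trivial split reads `B 0 = W 0 0 * (B 0 * B 0)`; cancelling `B 0` leaves a product equal to
  -- 1.
  B0 : B 0 ≡ 1
  B0 = ℕₚ.m*n≡1⇒n≡1 (W 0 0) (B 0) (sym (ℕₚ.*-cancelʳ-≡ 1 (W 0 0 * B 0) (B 0)
    (trans (ℕₚ.*-identityˡ (B 0)) (trans (split 0 0 refl) (sym (ℕₚ.*-assoc (W 0 0) (B 0) (B 0)))))))

  W-bottom : ∀ n → W n 0 ≡ 1
  W-bottom n = sym (ℕₚ.*-cancelʳ-≡ 1 (W n 0) (B n) (trans (ℕₚ.*-identityˡ (B n)) (trans (split 0 n refl)
    (cong (W n 0 *_) (trans (cong (_* B n) B0) (ℕₚ.*-identityˡ (B n)))))))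

  W-top : ∀ n → W n n ≡ 1
  W-top n = sym (ℕₚ.*-cancelʳ-≡ 1 (W n n) (B n) (trans (ℕₚ.*-identityˡ (B n)) (trans (split n 0 (ℕₚ.+-identityʳ n))
    (cong (W n n *_) (trans (cong (B n *_) B0) (ℕₚ.*-identityʳ (B n)))))))

  B-suc : ∀ n → B (suc n) ≡ A (suc n) * B n
  B-suc n = trans (split 1 n refl)
    (cong (A (suc n) *_) (trans (cong (_* B n) B1) (ℕₚ.*-identityˡ (B n))))

  -- Cutting off the bottom rank or the top rank expresses `B (suc n)` as a multiple of the same
  -- `B n`.
  W-coatoms : ∀ n → W (suc n) n ≡ A (suc n)
  W-coatoms n = ℕₚ.*-cancelʳ-≡ (W (suc n) n) (A (suc n)) (B n) (trans (sym (trans (split n 1 (ℕₚ.+-comm n 1))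
    (cong (W (suc n) n *_) (trans (cong (B n *_) B1) (ℕₚ.*-identityʳ (B n)))))) (B-suc n))

  -- The Euler relation of a 2m-interval (2m = 4 + double i), when the middle Whitney numbers are
  -- proportional to a sequence q with known alternating sum s; moved so that no subtraction occurs.
  even-relation : ∀ i p (q : ℕ → ℕ) s →
    (∀ a b → a + b ≡ double i →
      p * W (4 + double i) (2 + a) ≡ A (4 + double i) * A (3 + double i) * q (2 + a)) →
    sumTo (4 + double i) (λ k → + q k ℤ.* sign k) ≡ + s →
    q 0 ≡ 1 → q (4 + double i) ≡ 1 → q (3 + double i) ≡ q 1 →
    p * 2 + A (4 + double i) * A (3 + double i) * (2 * q 1 + s)
      ≡ p * (2 * A (4 + double i)) + A (4 + double i) * A (3 + double i) * 2
  even-relation i p q s middle q-sum q0 qN qN-1 = ℤₚ.+-injective (ℤₚ.i-j≡0⇒i≡j _ _ (begin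
    + (p * 2 + aa * (2 * q 1 + s)) ℤ.- + (p * (2 * a) + aa * 2)
      ≡⟨ cong₂ ℤ._-_ push-left push-right ⟩
    (+ p ℤ.* + 2 ℤ.+ + aa ℤ.* (+ 2 ℤ.* + q 1 ℤ.+ + s)) ℤ.- (+ p ℤ.* (+ 2 ℤ.* + a) ℤ.+ + aa ℤ.* + 2)
      ≡⟨ rearrange (+ p) (+ aa) (+ a) (+ q 1) (+ s) ⟩
    ends (+ p) (+ aa) (+ a) (+ q 1) ℤ.- (+ p ℤ.* 0ℤ ℤ.- + aa ℤ.* + s)
      ≡⟨ ℤₚ.i≡j⇒i-j≡0 (trans (sym by-ends) by-linearity) ⟩
    0ℤ ∎))
    where
    open ≡-Reasoning
    N = 4 + double i
    a = A N
    aa = A N * A (3 + double i)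
    -- The combination of the two alternating sums in which every middle term cancels. Its total is
    -- computed twice, by linearity and from the four outer terms.
    D : ℕ → ℤ
    D k = + p ℤ.* (+ W N k ℤ.* sign k) ℤ.- + aa ℤ.* (+ q k ℤ.* sign k)
    ends : ℤ → ℤ → ℤ → ℤ → ℤ
    ends p aa a q₁ =
      (p ℤ.* (1ℤ ℤ.* 1ℤ) ℤ.- aa ℤ.* (1ℤ ℤ.* 1ℤ)) ℤ.+ (p ℤ.* (a ℤ.* -1ℤ) ℤ.- aa ℤ.* (q₁ ℤ.* -1ℤ))
      ℤ.+ (p ℤ.* (a ℤ.* -1ℤ) ℤ.- aa ℤ.* (q₁ ℤ.* -1ℤ)) ℤ.+ (p ℤ.* (1ℤ ℤ.* 1ℤ) ℤ.- aa ℤ.* (1ℤ ℤ.* 1ℤ))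
    by-linearity : sumTo N D ≡ + p ℤ.* 0ℤ ℤ.- + aa ℤ.* + s
    by-linearity = trans (sumTo-linear N (+ p) (+ aa) (λ k → + W N k ℤ.* sign k) (λ k → + q k ℤ.* sign k))
      (cong₂ (λ u v → + p ℤ.* u ℤ.- + aa ℤ.* v) (euler (3 + double i)) q-sum)
    D-middle : ∀ k → k ≤ double i → D (2 + k) ≡ 0ℤ
    D-middle k k≤ = trans
      (factor (+ p) (+ W N (2 + k)) (+ aa) (+ q (2 + k)) (sign (2 + k)))
      (trans (cong (λ z → z ℤ.* sign (2 + k)) (ℤₚ.i≡j⇒i-j≡0
        (trans (sym (ℤₚ.pos-* p _)) (trans (cong +_ (middle k (double i ∸ k) (ℕₚ.m+[n∸m]≡n k≤))) (ℤₚ.pos-* aa _)))))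
        (ℤₚ.*-zeroˡ (sign (2 + k))))
      where
      factor : ∀ p w aa q s → p ℤ.* (w ℤ.* s) ℤ.- aa ℤ.* (q ℤ.* s) ≡ (p ℤ.* w ℤ.- aa ℤ.* q) ℤ.* s
      factor = ℤ-Ring.solve-∀
    D-at : ∀ k {w q′ s′} → W N k ≡ w → q k ≡ q′ → sign k ≡ s′ →
      D k ≡ + p ℤ.* (+ w ℤ.* s′) ℤ.- + aa ℤ.* (+ q′ ℤ.* s′)
    D-at k refl refl refl = refl
    sign-odd : sign (3 + double i) ≡ -1ℤ
    sign-odd = cong (-1ℤ ℤ.*_) (sign-double (suc i))
    by-ends : sumTo N D ≡ ends (+ p) (+ aa) (+ a) (+ q 1)
    by-ends = trans (sumTo-ends (double i) D D-middle)
      (cong₂ ℤ._+_ (cong₂ ℤ._+_ (cong₂ ℤ._+_ (D-at 0 (W-bottom N) q0 refl) (D-at 1 refl refl refl))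
        (D-at (3 + double i) (W-coatoms (3 + double i)) qN-1 sign-odd))
        (D-at N (W-top N) qN (sign-double (2 + i))))
    push-left : + (p * 2 + aa * (2 * q 1 + s)) ≡ + p ℤ.* + 2 ℤ.+ + aa ℤ.* (+ 2 ℤ.* + q 1 ℤ.+ + s)
    push-left = trans (ℤₚ.pos-+ (p * 2) _) (cong₂ ℤ._+_ (ℤₚ.pos-* p 2)
      (trans (ℤₚ.pos-* aa _) (cong (+ aa ℤ.*_) (trans (ℤₚ.pos-+ (2 * q 1) s) (cong (λ z → z ℤ.+ + s) (ℤₚ.pos-* 2 (q 1)))))))
    push-right : + (p * (2 * a) + aa * 2) ≡ + p ℤ.* (+ 2 ℤ.* + a) ℤ.+ + aa ℤ.* + 2
    push-right = trans (ℤₚ.pos-+ (p * (2 * a)) _) (cong₂ ℤ._+_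
      (trans (ℤₚ.pos-* p _) (cong (+ p ℤ.*_) (ℤₚ.pos-* 2 a))) (ℤₚ.pos-* aa 2))
    rearrange : ∀ p aa a q₁ s →
      (p ℤ.* + 2 ℤ.+ aa ℤ.* (+ 2 ℤ.* q₁ ℤ.+ s)) ℤ.- (p ℤ.* (+ 2 ℤ.* a) ℤ.+ aa ℤ.* + 2)
      ≡ ((p ℤ.* (1ℤ ℤ.* 1ℤ) ℤ.- aa ℤ.* (1ℤ ℤ.* 1ℤ)) ℤ.+ (p ℤ.* (a ℤ.* -1ℤ) ℤ.- aa ℤ.* (q₁ ℤ.* -1ℤ))
      ℤ.+ (p ℤ.* (a ℤ.* -1ℤ) ℤ.- aa ℤ.* (q₁ ℤ.* -1ℤ)) ℤ.+ (p ℤ.* (1ℤ ℤ.* 1ℤ) ℤ.- aa ℤ.* (1ℤ ℤ.* 1ℤ)))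
        ℤ.- (p ℤ.* 0ℤ ℤ.- aa ℤ.* s)
    rearrange = ℤ-Ring.solve-∀

  BooleanUpTo ButterflyUpTo : ℕ → Set
  BooleanUpTo m = ∀ k → k ≤ m → B k ≡ k !
  ButterflyUpTo m = ∀ k → suc k ≤ m → B (suc k) ≡ 2 ^ k

  -- With `K = 3 + double i`, the middle Whitney numbers are `A N * A K * (N - 2)!` divided by a
  -- product of two factorials, hence proportional to `N C k` with `p = N * K`. The alternating sum
  -- of binomials is 0, and a common factor `2 * K` cancels.
  boolean-relation : ∀ i → let N = 4 + double i in BooleanUpTo (2 + double i) →
    N + A N * A (3 + double i) ≡ N * A N
  boolean-relation i bool = ℕₚ.*-cancelˡ-≡ _ _ (2 * K) (ℕₚ.+-cancelʳ-≡ (aa * 2) _ _ (trans (left K aa)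
      (trans (even-relation i (N * K) (N C_) 0 middle (C-alternating K) C0 (nCn≡1 N) CK) (right K (A N) aa))))
    where
    K = 3 + double i
    N = suc K
    aa = A N * A K
    C0 : N C 0 ≡ 1
    C0 = trans (nCk≡nC[n∸k] {0} {N} z≤n) (nCn≡1 N)
    CK : N C K ≡ N C 1
    CK = trans (nCk≡nC[n∸k] {K} {N} (n≤1+n K)) (cong (N C_) (ℕₚ.m+n∸n≡m 1 K))
    left : ∀ K aa → 2 * K * (suc K + aa) + aa * 2 ≡ suc K * K * 2 + aa * (2 * (suc K C 1) + 0)
    left K aa rewrite nC1≡n (suc K) = solved K aa
      where
      solved : ∀ K aa → 2 * K * (suc K + aa) + aa * 2 ≡ suc K * K * 2 + aa * (2 * suc K + 0)
      solved = ℕ-Ring.solve-∀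
    right : ∀ K a aa → suc K * K * (2 * a) + aa * 2 ≡ 2 * K * (suc K * a) + aa * 2
    right = ℕ-Ring.solve-∀
    middle : ∀ a b → a + b ≡ double i → N * K * W N (2 + a) ≡ aa * (N C (2 + a))
    -- Both sides are multiplied by `f`, so that neither Whitney number nor binomial coefficient is
    -- expressed by a division.
    middle a b a+b = ℕₚ.*-cancelʳ-≡ _ _ f {{>-nonZero f-pos}} (begin
      N * K * W N (2 + a) * f
        ≡⟨ ℕₚ.*-assoc (N * K) (W N (2 + a)) f ⟩
      N * K * (W N (2 + a) * f)
        ≡⟨ cong (λ z → N * K * (W N (2 + a) * z)) (sym f-B) ⟩
      N * K * (W N (2 + a) * (B (2 + a) * B (2 + b)))
        ≡⟨ cong (N * K *_) (sym (split (2 + a) (2 + b) total)) ⟩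
      N * K * B N
        ≡⟨ cong (N * K *_) (trans (B-suc K) (cong (A N *_) (trans (B-suc (2 + double i)) (cong (A K *_) (bool _ ≤-refl))))) ⟩
      N * K * (A N * (A K * (2 + double i) !))
        ≡⟨ shuffle N K (A N) (A K) ((2 + double i) !) ⟩
      aa * N !
        ≡⟨ cong (aa *_) (sym (subst (λ t → (t C (2 + a)) * f ≡ t !) total (C-factorials (2 + a) (2 + b)))) ⟩
      aa * ((N C (2 + a)) * f)
        ≡⟨ sym (ℕₚ.*-assoc aa _ f) ⟩
      aa * (N C (2 + a)) * f ∎)
      where
      open ≡-Reasoning
      f = (2 + a) ! * (2 + b) !
      total : (2 + a) + (2 + b) ≡ N
      total = shift-middle a b a+b
      f-B : B (2 + a) * B (2 + b) ≡ f
      f-B = cong₂ _*_ (bool (2 + a) (ℕₚ.+-monoʳ-≤ 2 (subst (a ≤_) a+b (ℕₚ.m≤m+n a b))))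
        (bool (2 + b) (ℕₚ.+-monoʳ-≤ 2 (subst (b ≤_) a+b (ℕₚ.m≤n+m b a))))
      f-pos : 0 < f
      f-pos = subst (0 <_) f-B (ℕₚ.*-mono-< {0} {_} {0} (B-pos (2 + a)) (B-pos (2 + b)))
      shuffle : ∀ N K a a′ m → N * K * (a * (a′ * m)) ≡ a * a′ * (N * (K * m))
      shuffle = ℕ-Ring.solve-∀

  -- Here every middle Whitney number is half of `A N * A (3 + double i)`, so the comparison
  -- sequence is constantly 1 with `p = 2`; its alternating sum over an odd number of terms is 1.
  butterfly-relation : ∀ i → let N = 4 + double i in ButterflyUpTo (2 + double i) →
    4 + A N * A (3 + double i) ≡ 4 * A N
  butterfly-relation i butt = ℕₚ.+-cancelʳ-≡ (aa * 2) _ _ (trans (left aa)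
    (trans (even-relation i 2 (λ _ → 1) 1 middle
      (trans (sumTo-cong N λ k _ → ℤₚ.*-identityˡ (sign k)) (sumTo-sign-double (2 + i))) refl refl refl) (right aa (A N))))
    where
    K = 3 + double i
    N = suc K
    aa = A N * A K
    left : ∀ aa → 4 + aa + aa * 2 ≡ 2 * 2 + aa * (2 * 1 + 1)
    left = ℕ-Ring.solve-∀
    right : ∀ aa a → 2 * (2 * a) + aa * 2 ≡ 4 * a + aa * 2
    right = ℕ-Ring.solve-∀
    middle : ∀ a b → a + b ≡ double i → 2 * W N (2 + a) ≡ aa * 1
    middle a b a+b = ℕₚ.*-cancelʳ-≡ _ _ f {{ℕₚ.m^n≢0 2 (suc (double i))}} (begin
      2 * W N (2 + a) * f
        ≡⟨ shuffle₁ (W N (2 + a)) (2 ^ double i) ⟩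
      W N (2 + a) * (2 * (2 * 2 ^ double i))
        ≡⟨ cong (W N (2 + a) *_) (sym f-B) ⟩
      W N (2 + a) * (B (2 + a) * B (2 + b))
        ≡⟨ sym (split (2 + a) (2 + b) total) ⟩
      B N
        ≡⟨ trans (B-suc K) (cong (A N *_) (trans (B-suc (2 + double i)) (cong (A K *_) (butt _ ≤-refl)))) ⟩
      A N * (A K * f)
        ≡⟨ shuffle₂ (A N) (A K) f ⟩
      aa * 1 * f ∎)
      where
      open ≡-Reasoning
      f = 2 ^ suc (double i)
      total : (2 + a) + (2 + b) ≡ N
      total = shift-middle a b a+b
      f-B : B (2 + a) * B (2 + b) ≡ 2 * (2 * 2 ^ double i)
      f-B = trans (cong₂ _*_ (butt (1 + a) (ℕₚ.+-monoʳ-≤ 2 (subst (a ≤_) a+b (ℕₚ.m≤m+n a b))))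
        (butt (1 + b) (ℕₚ.+-monoʳ-≤ 2 (subst (b ≤_) a+b (ℕₚ.m≤n+m b a)))))
        (trans (shuffle₃ (2 ^ a) (2 ^ b)) (cong (λ z → 2 * (2 * z))
          (trans (sym (ℕₚ.^-distribˡ-+-* 2 a b)) (cong (2 ^_) a+b))))
        where
        shuffle₃ : ∀ x y → 2 * x * (2 * y) ≡ 2 * (2 * (x * y))
        shuffle₃ = ℕ-Ring.solve-∀
      shuffle₁ : ∀ w x → 2 * w * (2 * x) ≡ w * (2 * (2 * x))
      shuffle₁ = ℕ-Ring.solve-∀
      shuffle₂ : ∀ a b f → a * (b * f) ≡ a * b * 1 * f
      shuffle₂ = ℕ-Ring.solve-∀

  boolean-A : ∀ {m} → BooleanUpTo m → ∀ n → suc n ≤ m → A (suc n) ≡ suc n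
  boolean-A bool n n<m = ℕₚ.*-cancelʳ-≡ _ _ (B n) (trans (sym (B-suc n))
    (trans (bool (suc n) n<m) (cong (suc n *_) (sym (bool n (ℕₚ.<⇒≤ n<m))))))

  butterfly-A : ∀ {m} → ButterflyUpTo m → ∀ n → 2 + n ≤ m → A (2 + n) ≡ 2
  butterfly-A butt n n<m = ℕₚ.*-cancelʳ-≡ _ _ (B (suc n)) (trans (sym (B-suc (suc n)))
    (trans (butt (suc n) n<m) (cong (2 *_) (sym (butt n (ℕₚ.<⇒≤ n<m))))))

  upTo-suc : ∀ (Q : ℕ → Set) {m} → (∀ k → k ≤ m → Q k) → Q (suc m) → ∀ k → k ≤ suc m → Q k
  upTo-suc Q q qₘ k k≤ with ℕₚ.m≤n⇒m<n∨m≡n k≤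
  ... | inj₁ k< = q k (ℕₚ.≤-pred k<)
  ... | inj₂ refl = qₘ

  boolean-suc : ∀ {m} → BooleanUpTo m → A (suc m) ≡ suc m → BooleanUpTo (suc m)
  boolean-suc {m} bool a = upTo-suc (λ k → B k ≡ k !) bool
    (trans (B-suc m) (cong₂ _*_ a (bool m ≤-refl)))

  butterfly-suc : ∀ {m} → ButterflyUpTo (suc m) → A (2 + m) ≡ 2 → ButterflyUpTo (2 + m)
  butterfly-suc {m} butt a k (s≤s k≤) = upTo-suc (λ k → B (suc k) ≡ 2 ^ k) (λ k k≤ → butt k (s≤s k≤))
    (trans (B-suc (suc m)) (cong₂ _*_ a (butt m ≤-refl))) k k≤

  -- The Euler relation of a 2-interval is `1 - A 2 + 1 = 0`.
  A2 : A 2 ≡ 2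
  A2 = ℤₚ.+-injective (sym (ℤₚ.i-j≡0⇒i≡j (+ 2) (+ A 2) (trans (solved (+ A 2)) (trans
    (cong₂ (λ u v → + u ℤ.* 1ℤ ℤ.+ + A 2 ℤ.* -1ℤ ℤ.+ + v ℤ.* 1ℤ) (sym (W-bottom 2)) (sym (W-top 2))) (euler 1)))))
    where
    solved : ∀ a → + 2 ℤ.- a ≡ 1ℤ ℤ.* 1ℤ ℤ.+ a ℤ.* -1ℤ ℤ.+ 1ℤ ℤ.* 1ℤ
    solved = ℤ-Ring.solve-∀

  boolean-2 : BooleanUpTo 2
  boolean-2 = boolean-suc (boolean-suc (λ { .0 z≤n → B0 }) (W-top 1)) A2

  butterfly-2 : ButterflyUpTo 2
  butterfly-2 = butterfly-suc {0} (λ { zero _ → B1 ; (suc _) (s≤s ()) }) A2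

  -- If `a′` were at least `c`, then `a * a′` alone would reach `c * a`, leaving no room for `n`.
  bounded-by-relation : ∀ c n a a′ → 0 < n → n + a * a′ ≡ c * a → a′ < c
  bounded-by-relation c n a a′ n>0 rel = ℕₚ.≰⇒> λ c≤a′ → ℕₚ.<-irrefl (sym rel)
    (ℕₚ.≤-<-trans (≤-trans (ℕₚ.*-monoˡ-≤ a c≤a′) (≤-reflexive (ℕₚ.*-comm a′ a)))
      (ℕₚ.m<n+m (a * a′) n>0))

  -- The exception sits at `i = 0` because `2! = 2 ^ 1`: up to rank 2 the two types have the same
  -- factorial function.
  boolean-dichotomy : ∀ i → BooleanUpTo (2 + double i) →
    BooleanUpTo (4 + double i) ⊎ (i ≡ 0 × A (3 + double i) ≡ 2 × A (4 + double i) ≡ 2)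
  boolean-dichotomy i bool with A (3 + double i) ℕₚ.≟ 3 + double i
  -- Once `A (3 + double i)` has its Boolean value, the relation is linear in `A (4 + double i)` and
  -- determines it.
  ... | yes aK = inj₁ (boolean-suc (boolean-suc bool aK) (sym (ℕₚ.+-cancelʳ-≡ (A N * K) _ _
          (trans (cong (λ t → N + A N * t) (sym aK)) (trans (boolean-relation i bool) (cong (λ t → A N + t) (ℕₚ.*-comm K (A N))))))))
    where
    K = 3 + double i
    N = suc K
  ... | no aK≢ = inj₂ (only-4 i aK N-half M≤A)
    where
    K = 3 + double i
    M = 2 + double i
    N = suc K
    aM : A M ≡ M
    aM = boolean-A bool (suc (double i)) ≤-refl
    -- The relation gives `A K < N`, the value `K` is excluded in this branch, and monotonicity
    -- gives at least `A M = M`.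
    aK : A K ≡ M
    aK = ≤-antisym
      (ℕₚ.≤-pred (ℕₚ.≤∧≢⇒< (ℕₚ.≤-pred (bounded-by-relation N N (A N) (A K) (s≤s z≤n) (boolean-relation i bool))) aK≢))
      (≤-trans (≤-reflexive (sym aM)) (mono (suc (double i))))
    N-half : N ≡ 2 * A N
    N-half = ℕₚ.+-cancelʳ-≡ (A N * M) _ _ (trans (cong (λ t → N + A N * t) (sym aK))
      (trans (boolean-relation i bool) (solved M (A N))))
      where
      solved : ∀ M a → (2 + M) * a ≡ 2 * a + a * M
      solved = ℕ-Ring.solve-∀
    M≤A : M ≤ A N
    M≤A = ≤-trans (≤-reflexive (sym aK)) (mono M)
    -- From `N = 2 * A N` and `A N ≥ N - 2` follows `N ≤ 4`.
    only-4 : ∀ i → A (3 + double i) ≡ 2 + double i → 4 + double i ≡ 2 * A (4 + double i) →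
      2 + double i ≤ A (4 + double i) → i ≡ 0 × A (3 + double i) ≡ 2 × A (4 + double i) ≡ 2
    only-4 zero e half _ = refl , e , sym (ℕₚ.*-cancelˡ-≡ 2 _ 2 half)
    only-4 (suc j) _ half le = ⊥-elim (ℕₚ.<-irrefl half (≤-trans (bound (double j)) (ℕₚ.*-monoʳ-≤ 2 le)))
      where
      bound : ∀ d → 7 + d ≤ 2 * (4 + d)
      bound d = subst (7 + d ≤_) (sym (solved d)) (ℕₚ.m≤m+n (7 + d) (1 + d))
        where
        solved : ∀ d → 2 * (4 + d) ≡ 7 + d + (1 + d)
        solved = ℕ-Ring.solve-∀

  boolean-all : BooleanUpTo 4 → ∀ i → BooleanUpTo (2 + double i)
  boolean-all bool zero k k≤ = bool k (≤-trans k≤ (s≤s (s≤s z≤n)))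
  boolean-all bool (suc i) with boolean-dichotomy i (boolean-all bool i)
  ... | inj₁ b = b
  -- The exception needs `A 3 = 2`, whereas agreement with the factorial up to rank 4 gives
  -- `A 3 = 3`.
  ... | inj₂ (refl , a3 , _) = ⊥-elim (contra (trans (sym (boolean-A bool 2 (s≤s (s≤s (s≤s z≤n))))) a3))
    where
    contra : 3 ≢ 2
    contra ()

  -- The relation bounds `A K` below 4, `no-three` excludes 3, and monotonicity excludes anything
  -- below 2. With `A K = 2` the relation becomes `4 + 2 * A N = 4 * A N`.
  butterfly-step : A 3 ≡ 2 → ∀ j → ButterflyUpTo (4 + double j) → ButterflyUpTo (6 + double j)
  butterfly-step a3 j butt = butterfly-suc (butterfly-suc butt aK)
    (≤-antisym (ℕₚ.*-cancelˡ-≤ 2 aN≤) (≤-trans (≤-reflexive (sym aK)) (mono (2 + double i))))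
    where
    i = suc j
    K = 3 + double i
    N = suc K
    rel = butterfly-relation i butt
    aM : A (2 + double i) ≡ 2
    aM = butterfly-A butt (double i) ≤-refl
    aK : A K ≡ 2
    aK = ≤-antisym
      (ℕₚ.≤-pred (ℕₚ.≤∧≢⇒< (ℕₚ.≤-pred (bounded-by-relation 4 4 (A N) (A K) (s≤s z≤n) rel))
        (no-three (suc (double j)) A2 a3 aM)))
      (≤-trans (≤-reflexive (sym aM)) (mono (suc (double i))))
    aN≤ : 2 * A N ≤ 4
    aN≤ = ≤-reflexive (ℕₚ.+-cancelʳ-≡ (A N * 2) _ _ (sym (trans (cong (λ t → 4 + A N * t) (sym aK)) (trans rel (solved (A N))))))
      where
      solved : ∀ a → 4 * a ≡ 2 * a + a * 2
      solved = ℕ-Ring.solve-∀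

  -- Ranks 3 and 4 are supplied by the exceptional branch of `boolean-dichotomy`; `butterfly-step`
  -- takes over from rank 5.
  butterfly-all : A 3 ≡ 2 → A 4 ≡ 2 → ∀ i → ButterflyUpTo (2 + double i)
  butterfly-all a3 a4 zero = butterfly-2
  butterfly-all a3 a4 (suc zero) = butterfly-suc (butterfly-suc butterfly-2 a3) a4
  butterfly-all a3 a4 (suc (suc j)) = butterfly-step a3 j (butterfly-all a3 a4 (suc j))

  ≤-double : ∀ n → n ≤ double n
  ≤-double zero = z≤n
  ≤-double (suc n) = s≤s (≤-trans (≤-double n) (n≤1+n _))

  classification :
    ((∀ n → B n ≡ n !) × (∀ n → A (suc n) ≡ suc n)) ⊎
    ((∀ n → B (suc n) ≡ 2 ^ n) × (∀ n → A (2 + n) ≡ 2))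
  classification with boolean-dichotomy 0 boolean-2
  ... | inj₁ bool = inj₁
    ( (λ n → boolean-all bool n n (below n))
    , λ n → boolean-A (boolean-all bool (suc n)) n (below (suc n)) )
    where
    below : ∀ n → n ≤ 2 + double n
    below n = ≤-trans (≤-double n) (≤-trans (n≤1+n _) (n≤1+n _))
  ... | inj₂ (_ , a3 , a4) = inj₂
    ( (λ n → butterfly-all a3 a4 n n (s≤s (≤-trans (≤-double n) (n≤1+n _))))
    , λ n → butterfly-A (butterfly-all a3 a4 n) n (s≤s (s≤s (≤-double n))) )

-- Structure of intervals

-- A labelling of a two-element list by `Bool`, in the shape of the constructor `mid`.
record Pair {A : Set} (L : List A) : Set where
  field
    pick           : Bool → A
    pick-∈         : ∀ b → pick b ∈ L
    pick-injective : ∀ b b′ → pick b ≡ pick b′ → b ≡ b′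
    pick-covers    : ∀ {z} → z ∈ L → ∃ λ b → pick b ≡ z

pair : ∀ {A : Set} {L : List A} → Unique L → length L ≡ 2 → Pair L
pair {L = p ∷ q ∷ []} ((p≢q ∷ []) ∷ _) _ = record
  { pick = λ { true → p ; false → q }
  ; pick-∈ = λ { true → here refl ; false → there (here refl) }
  ; pick-injective = λ { true true _ → refl ; false false _ → refl
                       ; true false e → ⊥-elim (p≢q e) ; false true e → ⊥-elim (p≢q (sym e)) }
  ; pick-covers = λ { (here refl) → true , refl ; (there (here refl)) → false , refl }
  }

-- Whitney numbers of an Eulerian binomial poset

module EulerianBinomial (P : LFPoset) (ρ : LFPoset.Carrier P → ℕ) (isRank : IsRankFunction P ρ)
  (B : ℕ → ℕ) (fact : IsFactorialFunction P ρ B) (chain : HasInfiniteChain P) (eul : IsEulerian P ρ) where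
  open Binomial P ρ isRank B fact public

  -- Ranks along the infinite chain are unbounded, but the chain may skip rank `n`; `between-rank`
  -- supplies an element there.
  interval-exists : ∀ n → ∃₂ (IsInterval n)
  interval-exists n =
    let z , xz , _ , ρz = between-rank n (chain-⊑ n) (chain-ρ n) in c 0 , z , xz , ρz
    where
    c = proj₁ chain
    chain-⊑ : ∀ i → c 0 ⊑ c i
    chain-⊑ zero = ⊑-refl
    chain-⊑ (suc i) = ⊑-trans (chain-⊑ i) (proj₁ (proj₂ chain i))
    chain-ρ : ∀ i → i + ρ (c 0) ≤ ρ (c i)
    chain-ρ zero = ≤-refl
    chain-ρ (suc i) = ≤-trans (s≤s (chain-ρ i)) (ρ-strict (proj₂ chain i))

  B-positive : ∀ n → 0 < B n
  B-positive n = let x , y , i = interval-exists n in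
    subst (0 <_) (chains-length i) (∈-length (chains-complete (proj₂ (maxChain-exists (proj₁ i)))))

  instance
    B-nonZero : ∀ {n} → NonZero (B n)
    B-nonZero = >-nonZero (B-positive _)

  B1 : B 1 ≡ 1
  B1 with interval-exists 1
  ... | x , y , i@(_ , ρy) = ≤-antisym
    (subst (_≤ 1) (chains-length i) (length-mono {ys = (x ∷ y ∷ []) ∷ []} (chains-unique x y)
      λ c∈ → here (only (chains-sound c∈) ρy)))
    (B-positive 1)
    where
    only : ∀ {x y c} → MaxChain P x y c → ρ y ≡ 1 + ρ x → c ≡ x ∷ y ∷ []
    only {x} (single _) e = ⊥-elim (ℕₚ.1+n≢n (sym e))
    only (step _ (single _)) _ = refl
    only (step cov (step cov′ mc)) e = ⊥-elim (ℕₚ.<-irrefl refl (begin-strict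
      _ <⟨ ≤-refl ⟩
      _ ≡⟨ cong suc (sym (ρ-cover cov)) ⟩
      _ ≡⟨ sym (ρ-cover cov′) ⟩
      _ ≤⟨ maxChain-ρ mc ⟩
      _ ≡⟨ e ⟩
      _ ∎))
      where open ℕₚ.≤-Reasoning

  -- Measured in one chosen interval; `elems-length` shows that the choice does not matter.
  W : ℕ → ℕ → ℕ
  W n r = let x , y , _ = interval-exists n in length (elems r x y)

  W-split : ∀ r s {n} → r + s ≡ n → B n ≡ W n r * (B r * B s)
  W-split r s refl = count r s (proj₂ (proj₂ (interval-exists (r + s))))

  -- Both counts satisfy the product formula for `B n` with the same nonzero factor.
  elems-length : ∀ {r s n x y} → r + s ≡ n → IsInterval n x y → length (elems r x y) ≡ W n r
  elems-length {r} {s} refl i = ℕₚ.*-cancelʳ-≡ _ _ (B r * B s) {{ℕₚ.m*n≢0 (B r) (B s)}}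
    (trans (sym (count r s i)) (W-split r s refl))

  atoms : Carrier → Carrier → List Carrier
  atoms = elems 1

  atoms-length : ∀ {n x y} → IsInterval (suc n) x y → length (atoms x y) ≡ W (suc n) 1
  atoms-length = elems-length refl

  atoms-⊆ : ∀ {x z y} → z ⊑ y → ∀ {a} → a ∈ atoms x z → a ∈ atoms x y
  atoms-⊆ zy a∈ = let xa , az , ρa = elems-∈ a∈ in ∈-elems {1} xa (⊑-trans az zy) ρa

  elem-of-rank : ∀ r s {n x y} → r + s ≡ n → IsInterval n x y →
    ∃ λ z → IsInterval r x z × IsInterval s z y
  elem-of-rank r s {x = x} refl (xy , ρy) =
    let z , xz , zy , ρz = between-rank r xy (≤-trans (ℕₚ.+-monoˡ-≤ (ρ x) (ℕₚ.m≤m+n r s)) (≤-reflexive (sym ρy)))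
    in z , elems-interval r s ρy (∈-elems {r} xz zy ρz)

  -- The atoms below a coatom are among the atoms of the whole interval.
  W-mono : ∀ n → W (suc n) 1 ≤ W (suc (suc n)) 1
  W-mono n =
    let x , y , i = interval-exists (suc (suc n))
        z , j , (zy , _) = elem-of-rank (suc n) 1 (ℕₚ.+-comm (suc n) 1) i
    in subst₂ _≤_ (atoms-length j) (atoms-length i) (length-mono (elems-unique 1 x z) (atoms-⊆ zy))

  interval-trans : ∀ {r s x y z} → IsInterval r x y → IsInterval s y z → IsInterval (r + s) x z
  interval-trans {r} {s} {x} (xy , ρy) (yz , ρz) = ⊑-trans xy yz ,
    trans ρz (trans (cong (λ t → s + t) ρy) (trans (sym (ℕₚ.+-assoc s r (ρ x))) (cong (λ t → t + ρ x) (ℕₚ.+-comm s r))))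

  -- Two rank-2 elements over a common atom d have an upper bound of rank 3 (both are atoms of [d, y]),
  -- and hence the same two atoms.
  module CommonAtom (n : ℕ) (w2 : W 2 1 ≡ 2) (w3 : W 3 1 ≡ 2) (w3+n : W (3 + n) 1 ≡ 2)
    {x y : Carrier} (i : IsInterval (4 + n) x y) where

    -- The intervals `[d, w]` and `[d, y]` both have two atoms, so these coincide; `v` is one of
    -- them and hence lies below `w`.
    cover-⊑ : ∀ {d v w} → d ∈ atoms x y → d ⊑ v → IsInterval 2 x v → v ⊑ y →
      d ⊑ w → IsInterval 3 x w → w ⊑ y → v ⊑ w
    cover-⊑ {d} {v} {w} d∈ dv iv vy dw iw wy with elems-interval 1 (3 + n) (proj₂ i) d∈
    ... | (xd , ρd) , dy = proj₁ (proj₂ (elems-∈ {1} v∈))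
      where
      d-w : IsInterval 2 d w
      d-w = dw , trans (proj₂ iw) (cong (λ t → 2 + t) (sym ρd))
      v∈ : v ∈ atoms d w
      v∈ = mono-length-⊇ _≟_ (elems-unique 1 d w) (atoms-⊆ wy)
        (≤-reflexive (trans (trans (atoms-length dy) w3+n) (sym (trans (atoms-length d-w) w2))))
        (∈-elems {1} dv vy (trans (proj₂ iv) (cong suc (sym ρd))))

    same-atoms : ∀ {u v d c} → IsInterval 2 x u → u ⊑ y → IsInterval 2 x v → v ⊑ y →
      d ∈ atoms x y → d ⊑ u → d ⊑ v → c ∈ atoms x v → c ⊑ u
    same-atoms {u} {v} {d} {c} iu uy iv vy d∈ du dv c∈
      -- Some `w` of rank 3 lies above `u`, and `cover-⊑` puts `v` below it. As `[x, u]` and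
      -- `[x, w]` both have two atoms, the atom `c` of `[x, v]` is an atom of `[x, u]`.
      with elem-of-rank 1 (1 + n) refl (uy , rank-u)
      where
      rank-u : ρ y ≡ 2 + n + ρ u
      rank-u = trans (proj₂ i) (trans (cong (λ t → 2 + t) (trans (cong suc (sym (ℕₚ.+-suc n (ρ x)))) (sym (ℕₚ.+-suc n (suc (ρ x))))))
        (cong (λ t → 2 + n + t) (sym (proj₂ iu))))
    ... | w , uw , (wy , _) = proj₁ (proj₂ (elems-∈ {1} c∈u))
      where
      iw : IsInterval 3 x w
      iw = interval-trans iu uw
      c∈u : c ∈ atoms x u
      c∈u = mono-length-⊇ _≟_ (elems-unique 1 x u) (atoms-⊆ (proj₁ uw))
        (≤-reflexive (trans (trans (atoms-length iw) w3) (sym (trans (atoms-length iu) w2))))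
        (atoms-⊆ (cover-⊑ d∈ dv iv vy (⊑-trans du (proj₁ uw)) iw wy) c∈)

    -- Otherwise the two atoms of u and the two atoms of v are disjoint, which makes four.
    no-third-atom : W (4 + n) 1 ≡ 3 → ∀ {u v c} → IsInterval 2 x u → u ⊑ y → IsInterval 2 x v → v ⊑ y →
      c ∈ atoms x v → c ⊑ u
    no-third-atom w4+n {u} {v} {c} iu uy iv vy c∈ = decidable-stable (c ⊑? u) λ c⋢u →
      ℕₚ.<-irrefl refl (subst₂ _≤_ four (trans (atoms-length i) w4+n)
        (length-mono (++⁺ (elems-unique 1 x u) (elems-unique 1 x v) (disjoint c⋢u)) both))
      where
      four : length (atoms x u ++ atoms x v) ≡ 4
      four = trans (length-++ (atoms x u))
        (cong₂ _+_ (trans (atoms-length iu) w2) (trans (atoms-length iv) w2))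
      disjoint : ¬ (c ⊑ u) → ∀ {d} → ¬ (d ∈ atoms x u × d ∈ atoms x v)
      disjoint c⋢u (d∈u , d∈v) = c⋢u (same-atoms iu uy iv vy (atoms-⊆ vy d∈v)
        (proj₁ (proj₂ (elems-∈ {1} d∈u))) (proj₁ (proj₂ (elems-∈ {1} d∈v))) c∈)
      both : ∀ {d} → d ∈ atoms x u ++ atoms x v → d ∈ atoms x y
      both d∈ with ∈-++⁻ (atoms x u) d∈
      ... | inj₁ p = atoms-⊆ uy p
      ... | inj₂ p = atoms-⊆ vy p

  -- Every atom `c` lies below some `v` of rank 2, hence below a fixed `u` of rank 2 by
  -- `no-third-atom`; but `u` has only two atoms.
  no-three-atoms : ∀ n → W 2 1 ≡ 2 → W 3 1 ≡ 2 → W (3 + n) 1 ≡ 2 → W (4 + n) 1 ≢ 3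
  no-three-atoms n w2 w3 w3+n w4+n = contradiction (proj₂ (proj₂ (interval-exists (4 + n))))
    where
    contradiction : ∀ {x y} → IsInterval (4 + n) x y → ⊥
    contradiction {x} {y} i =
      let u , iu , (uy , _) = elem-of-rank 2 (2 + n) refl i
      in ℕₚ.<-irrefl refl (subst₂ _≤_ (trans (atoms-length i) w4+n) (trans (atoms-length iu) w2)
        (length-mono (elems-unique 1 x y) λ c∈ →
          let ic , jc = elems-interval 1 (3 + n) (proj₂ i) c∈
              v , kv , (vy , _) = elem-of-rank 1 (2 + n) refl jc
          in ∈-elems {1} (proj₁ ic) (no-third-atom w4+n iu uy (interval-trans ic kv) vy
               (∈-elems {1} (proj₁ ic) (proj₁ kv) (proj₂ ic))) (proj₂ ic)))
      where open CommonAtom n w2 w3 w3+n i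

  open Möbius P ρ isRank using (euler-relation)

  W-euler : ∀ n → sumTo (suc n) (λ k → + W (suc n) k ℤ.* sign k) ≡ 0ℤ
  W-euler n = let _ , _ , xy , ρy = interval-exists (suc n) in euler-relation eul {n} xy ρy

  open Numerics B W B-positive B1 W-split W-euler W-mono no-three-atoms public
    using (classification; W-coatoms; B0)

  -- The butterfly case

  module ButterflyIntervals (B-pow : ∀ n → B (suc n) ≡ 2 ^ n) (two-atoms : ∀ n → W (2 + n) 1 ≡ 2) where

    rank-pair : ∀ a b → W (suc a + suc b) (suc a) ≡ 2
    rank-pair a b = ℕₚ.*-cancelʳ-≡ _ _ (2 ^ a * 2 ^ b) {{ℕₚ.m*n≢0 (2 ^ a) (2 ^ b) {{ℕₚ.m^n≢0 2 a}} {{ℕₚ.m^n≢0 2 b}}}} (begin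
      W (suc a + suc b) (suc a) * (2 ^ a * 2 ^ b)
        ≡⟨ cong (W (suc a + suc b) (suc a) *_) (cong₂ _*_ (sym (B-pow a)) (sym (B-pow b))) ⟩
      W (suc a + suc b) (suc a) * (B (suc a) * B (suc b))
        ≡⟨ sym (W-split (suc a) (suc b) refl) ⟩
      B (suc a + suc b)
        ≡⟨ B-pow (a + suc b) ⟩
      2 ^ (a + suc b)
        ≡⟨ cong (2 ^_) (ℕₚ.+-suc a b) ⟩
      2 * 2 ^ (a + b)
        ≡⟨ cong (2 *_) (ℕₚ.^-distribˡ-+-* 2 a b) ⟩
      2 * (2 ^ a * 2 ^ b) ∎)
      where open ≡-Reasoning

    as-interval : ∀ r {x y} → x ⊑ y → r + ρ x ≤ ρ y → ∃ λ m → IsInterval (r + m) x y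
    as-interval r {x} {y} xy le = ρ y ∸ (r + ρ x) , xy , sym (trans (solved r _ (ρ x)) (ℕₚ.m∸n+n≡m le))
      where
      solved : ∀ r m c → r + m + c ≡ m + (r + c)
      solved = ℕ-Ring.solve-∀

    -- The atoms of [x, w] are two of, hence all of, the atoms of [x, y].
    atom-⊑ : ∀ {x y a w} → a ∈ atoms x y → x ⊑ w → w ⊑ y → 2 + ρ x ≤ ρ w → a ⊑ w
    atom-⊑ {x} {y} {a} {w} a∈ xw wy le with as-interval 2 xw le | as-interval 2 (⊑-trans xw wy) (≤-trans le (ρ-mono wy))
    ... | m , iw | m′ , iy = proj₁ (proj₂ (elems-∈ {1} (mono-length-⊇ _≟_ (elems-unique 1 x w) (atoms-⊆ wy)
      (≤-reflexive (trans (trans (atoms-length iy) (two-atoms m′)) (sym (trans (atoms-length iw) (two-atoms m))))) a∈)))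

    -- Induction on the rank of `z` above `x`: an atom `a` of `[x, z]` replaces `x`, and `atom-⊑`
    -- applies because `w` has rank at least 2 above `x`.
    butterfly-order : ∀ k {x y z w} → ρ z ≡ k + ρ x → x ⊑ z → z ⊑ y → x ⊑ w → w ⊑ y → ρ z < ρ w → z ⊑ w
    butterfly-order zero {w = w} ρz xz _ xw _ _ = subst (_⊑ w) (ρ-injective xz (≤-reflexive ρz)) xw
    butterfly-order (suc k) {x} ρz xz zy xw wy zw with elem-of-rank 1 k refl (xz , ρz)
    ... | a , (xa , ρa) , (az , ρz′) = butterfly-order k ρz′ az zy
      (atom-⊑ (∈-elems {1} xa (⊑-trans az zy) ρa) xw wy
        (≤-trans (s≤s (≤-trans (s≤s (ℕₚ.m≤n+m (ρ x) k)) (≤-reflexive (sym ρz)))) zw)) wy zw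

    level : ∀ {m x y} → IsInterval (suc m) x y → (j : Fin m) → Pair (elems (suc (toℕ j)) x y)
    level {m} {x} {y} i j = pair (elems-unique (suc (toℕ j)) x y) (trans (elems-length total i)
      (subst (λ t → W t (suc (toℕ j)) ≡ 2) total (rank-pair (toℕ j) (m ∸ suc (toℕ j)))))
      where
      total : suc (toℕ j) + suc (m ∸ suc (toℕ j)) ≡ suc m
      total = trans (ℕₚ.+-suc (suc (toℕ j)) _) (cong suc (ℕₚ.m+[n∸m]≡n (Finₚ.toℕ<n j)))

    module ButterflyIso {m : ℕ} {x y : Carrier} (i : IsInterval (suc m) x y)
      (levels : (j : Fin m) → Pair (elems (suc (toℕ j)) x y)) where

      xy = proj₁ i
      ρy = proj₂ i

      open module Level j = Pair (levels j)

      -- Any labelling of the two elements of a rank will do, since comparability between different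
      -- ranks depends on the ranks alone.
      embed : Butterfly (suc m) → Carrier
      embed bot = x
      embed top = y
      embed (mid j b) = pick j b

      embed-bounds : ∀ a → x ⊑ embed a × embed a ⊑ y
      embed-bounds bot = ⊑-refl , xy
      embed-bounds top = xy , ⊑-refl
      embed-bounds (mid j b) = let p , q , _ = elems-∈ (pick-∈ j b) in p , q

      embed-rank : ∀ a → ρ (embed a) ≡ bRank a + ρ x
      embed-rank bot = refl
      embed-rank top = ρy
      embed-rank (mid j b) = proj₂ (proj₂ (elems-∈ (pick-∈ j b)))

      embed-covers : ∀ z → x ⊑ z → z ⊑ y → ∃ λ a → embed a ≡ z
      embed-covers z xz zy with ρ z ∸ ρ x in eq
      ... | zero = bot , ρ-injective xz (ℕₚ.m∸n≡0⇒m≤n eq)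
      ... | suc k with k ℕₚ.<? m
      ... | yes k<m =
        let b , e = pick-covers (fromℕ< k<m) (∈-elems xz zy
              (trans (sym (ℕₚ.m∸n+n≡m (ρ-mono xz))) (cong (_+ ρ x) (trans eq (cong suc (sym (Finₚ.toℕ-fromℕ< k<m)))))))
        in mid (fromℕ< k<m) b , e
      ... | no k≮m = top , sym (ρ-injective zy (≤-trans (≤-reflexive ρy)
        (≤-trans (ℕₚ.+-monoˡ-≤ (ρ x) (s≤s (ℕₚ.≮⇒≥ k≮m))) (≤-reflexive (trans (cong (_+ ρ x) (sym eq)) (ℕₚ.m∸n+n≡m (ρ-mono xz)))))))

      same-rank : ∀ a b → embed a ≡ embed b → bRank a ≡ bRank b
      same-rank a b e = ℕₚ.+-cancelʳ-≡ (ρ x) _ _ (trans (sym (embed-rank a)) (trans (cong ρ e) (embed-rank b)))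

      embed-injective : ∀ a b → bRank a ≡ bRank b → embed a ≡ embed b → a ≡ b
      embed-injective bot bot _ _ = refl
      embed-injective top top _ _ = refl
      embed-injective top (mid j _) r _ = ⊥-elim (ℕₚ.<⇒≢ (Finₚ.toℕ<n j) (sym (ℕₚ.suc-injective r)))
      embed-injective (mid j _) top r _ = ⊥-elim (ℕₚ.<⇒≢ (Finₚ.toℕ<n j) (ℕₚ.suc-injective r))
      embed-injective (mid j b) (mid j′ b′) r e with Finₚ.toℕ-injective (ℕₚ.suc-injective r)
      ... | refl = cong (mid j) (pick-injective j b b′ e)

      embed-order : ∀ a b → (embed a ⊑ embed b) ⇔ (a ≤T b)
      embed-order a b = mk⇔ to from
        where
        to : embed a ⊑ embed b → a ≤T b
        to le with bRank a ℕₚ.<? bRank b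
        ... | yes lt = inj₂ lt
        ... | no ≮ = inj₁ (embed-injective a b (same-rank a b e) e)
          where
          e : embed a ≡ embed b
          e = ρ-injective le (subst₂ _≤_ (sym (embed-rank b)) (sym (embed-rank a)) (ℕₚ.+-monoˡ-≤ (ρ x) (ℕₚ.≮⇒≥ ≮)))
        from : a ≤T b → embed a ⊑ embed b
        from (inj₁ refl) = ⊑-refl
        from (inj₂ lt) = butterfly-order (bRank a) (embed-rank a)
          (proj₁ (embed-bounds a)) (proj₂ (embed-bounds a)) (proj₁ (embed-bounds b)) (proj₂ (embed-bounds b))
          (subst₂ _<_ (sym (embed-rank a)) (sym (embed-rank b)) (ℕₚ.+-monoˡ-< (ρ x) lt))

      butterfly-iso : IntervalIso P x y (Butterfly (suc m)) _≤T_
      butterfly-iso = embed , embed-bounds , embed-covers , embed-order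

    butterfly-intervals : ∀ x y → x ⊑ y → ρ x < ρ y → IntervalIso P x y (Butterfly (ρ y ∸ ρ x)) _≤T_
    butterfly-intervals x y xy lt with as-interval 1 xy lt
    ... | m , i = subst (λ n → IntervalIso P x y (Butterfly n) _≤T_)
      (sym (trans (cong (_∸ ρ x) (proj₂ i)) (ℕₚ.m+n∸n≡m (suc m) (ρ x)))) (ButterflyIso.butterfly-iso i (level i))

  -- The Boolean case

  module BooleanIntervals (A≡id : ∀ n → W (suc n) 1 ≡ suc n) where

    atom-⊑ : ∀ {x y a} → a ∈ atoms x y → a ⊑ y
    atom-⊑ a∈ = proj₁ (proj₂ (elems-∈ {1} a∈))

    atom-restrict : ∀ {x y z a} → a ∈ atoms x y → a ⊑ z → a ∈ atoms x z
    atom-restrict a∈ az = let xa , _ , ρa = elems-∈ {1} a∈ in ∈-elems {1} xa az ρa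

    no-atoms : ∀ {x y a} → ρ y ≡ ρ x → ¬ (a ∈ atoms x y)
    no-atoms e a∈ = let xa , ay , ρa = elems-∈ {1} a∈ in
      ℕₚ.<-irrefl (sym e) (≤-trans (≤-reflexive (sym ρa)) (ρ-mono ay))

    atoms-count : ∀ {n x y} → IsInterval n x y → length (atoms x y) ≡ n
    atoms-count {zero} {x} {y} (_ , ρy) = ℕₚ.n≤0⇒n≡0 (length-mono {ys = []} (elems-unique 1 x y)
      λ a∈ → ⊥-elim (no-atoms ρy a∈))
    atoms-count {suc n} i = trans (atoms-length i) (A≡id n)

    coatom? : ∀ y z → Dec (suc (ρ z) ≡ ρ y)
    coatom? y z = suc (ρ z) ℕₚ.≟ ρ y

    -- Measured from the top, so that membership passes between `[z, y]` and `[x, y]` without a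
    -- shift of rank.
    coatoms : Carrier → Carrier → List Carrier
    coatoms x y = filter (coatom? y) (interval x y)

    coatoms-unique : ∀ x y → Unique (coatoms x y)
    coatoms-unique x y = filter⁺ (coatom? y) (interval-uniq x y)

    ∈-coatoms : ∀ {x y c} → x ⊑ c → c ⊑ y → suc (ρ c) ≡ ρ y → c ∈ coatoms x y
    ∈-coatoms {y = y} xc cy e = ∈-filter⁺ (coatom? y) (∈-interval xc cy) e

    coatoms-∈ : ∀ {x y c} → c ∈ coatoms x y → x ⊑ c × c ⊑ y × suc (ρ c) ≡ ρ y
    coatoms-∈ {x} {y} c∈ with ∈-filter⁻ (coatom? y) {xs = interval x y} c∈
    ... | c∈′ , e = let p , q = interval-bounds c∈′ in p , q , e

    coatoms-count : ∀ {n x y} → IsInterval n x y → length (coatoms x y) ≡ n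
    coatoms-count {zero} {x} {y} (_ , ρy) = ℕₚ.n≤0⇒n≡0 (length-mono {ys = []} (coatoms-unique x y)
      λ c∈ → let xc , _ , e = coatoms-∈ c∈ in ⊥-elim (ℕₚ.<-irrefl (sym ρy) (≤-trans (s≤s (ρ-mono xc)) (≤-reflexive e))))
    coatoms-count {suc n} {x} {y} i@(_ , ρy) = trans
      (≤-antisym (length-mono (coatoms-unique x y) to) (length-mono (elems-unique n x y) from))
      (trans (elems-length (ℕₚ.+-comm n 1) i) (trans (W-coatoms n) (A≡id n)))
      where
      to : ∀ {c} → c ∈ coatoms x y → c ∈ elems n x y
      to c∈ = let xc , cy , e = coatoms-∈ c∈ in ∈-elems {n} xc cy (ℕₚ.suc-injective (trans e ρy))
      from : ∀ {c} → c ∈ elems n x y → c ∈ coatoms x y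
      from c∈ = let xc , cy , e = elems-∈ {n} c∈ in ∈-coatoms xc cy (trans (cong suc e) (sym ρy))

    coatom-interval : ∀ {n x y c} → IsInterval (suc n) x y → c ∈ coatoms x y → IsInterval n x c
    coatom-interval (_ , ρy) c∈ = let xc , _ , e = coatoms-∈ c∈ in xc , ℕₚ.suc-injective (trans e ρy)

    -- Otherwise the `n` atoms of `[x, y]` would all be among the `m` atoms of `[x, z]`.
    missing-atom : ∀ {n m x y z} → IsInterval n x y → IsInterval m x z → m < n →
      ∃ λ a → a ∈ atoms x y × ¬ (a ⊑ z)
    missing-atom {x = x} {y} {z} i j m<n with any? (λ a → ¬? (a ⊑? z)) (atoms x y)
    ... | yes p = find p
    ... | no none = ⊥-elim (ℕₚ.<⇒≱ m<n (subst₂ _≤_ (atoms-count i) (atoms-count j)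
      (length-mono (elems-unique 1 x y) λ {a} a∈ → atom-restrict a∈
        (decidable-stable (a ⊑? z) λ a⋢z → none (lose a∈ a⋢z)))))

    missing-coatom : ∀ {n m x y z} → IsInterval n x y → IsInterval m z y → m < n → x ⊑ z →
      ∃ λ c → c ∈ coatoms x y × ¬ (z ⊑ c)
    missing-coatom {x = x} {y} {z} i j m<n xz with any? (λ c → ¬? (z ⊑? c)) (coatoms x y)
    ... | yes p = find p
    ... | no none = ⊥-elim (ℕₚ.<⇒≱ m<n (subst₂ _≤_ (coatoms-count i) (coatoms-count j)
      (length-mono (coatoms-unique x y) λ {c} c∈ → let _ , cy , e = coatoms-∈ c∈ in
        ∈-coatoms (decidable-stable (z ⊑? c) λ z⋢c → none (lose c∈ z⋢c)) cy e)))

    -- The interval `[x, c]` already contains `n` of the `n + 1` atoms.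
    missing-atom-unique : ∀ {n x y c a b} → IsInterval (suc n) x y → c ∈ coatoms x y →
      a ∈ atoms x y → b ∈ atoms x y → ¬ (a ⊑ c) → ¬ (b ⊑ c) → a ≡ b
    missing-atom-unique {n} {x} {y} {c} {a} {b} i c∈ a∈ b∈ a⋢c b⋢c = decidable-stable (a ≟ b) λ a≢b →
      ℕₚ.<-irrefl refl (subst₂ _≤_ (cong (λ t → 2 + t) (atoms-count (coatom-interval i c∈))) (atoms-count i)
        (length-mono {xs = a ∷ b ∷ atoms x c}
          ((a≢b ∷ fresh a⋢c) ∷ fresh b⋢c ∷ elems-unique 1 x c)
          λ { (here refl) → a∈ ; (there (here refl)) → b∈
            ; (there (there p)) → atoms-⊆ (proj₁ (proj₂ (coatoms-∈ c∈))) p }))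
      where
      fresh : ∀ {a} → ¬ (a ⊑ c) → All (λ d → a ≢ d) (atoms x c)
      fresh a⋢c = All.tabulate λ { d∈ refl → a⋢c (atom-⊑ d∈) }

    -- Dually, `[a, y]` already contains `n` of the `n + 1` coatoms.
    missing-coatom-unique : ∀ {n x y a c d} → IsInterval (suc n) x y → a ∈ atoms x y →
      c ∈ coatoms x y → d ∈ coatoms x y → ¬ (a ⊑ c) → ¬ (a ⊑ d) → c ≡ d
    missing-coatom-unique {n} {x} {y} {a} {c} {d} i a∈ c∈ d∈ a⋢c a⋢d = decidable-stable (c ≟ d) λ c≢d →
      ℕₚ.<-irrefl refl (subst₂ _≤_
        (cong (λ t → 2 + t) (coatoms-count (proj₂ (elems-interval 1 n (proj₂ i) a∈)))) (coatoms-count i)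
        (length-mono {xs = c ∷ d ∷ coatoms a y}
          ((c≢d ∷ fresh a⋢c) ∷ fresh a⋢d ∷ coatoms-unique a y)
          λ { (here refl) → c∈ ; (there (here refl)) → d∈
            ; (there (there p)) → let ae , ey , e = coatoms-∈ p in
                ∈-coatoms (⊑-trans (proj₁ (elems-∈ {1} a∈)) ae) ey e }))
      where
      fresh : ∀ {c} → ¬ (a ⊑ c) → All (λ d → c ≢ d) (coatoms a y)
      fresh a⋢c = All.tabulate λ { e∈ refl → a⋢c (proj₁ (coatoms-∈ e∈)) }

    -- Were z ⋢ c, the coatoms above z together with c would miss distinct atoms, none of them below z:
    -- more atoms than there are.
    ⊑-coatom : ∀ {n x y z b c} → IsInterval (suc n) x y → x ⊑ z → z ⊑ y → b ∈ atoms x y → ¬ (b ⊑ z) →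
      c ∈ coatoms x y → ¬ (b ⊑ c) → z ⊑ c
    ⊑-coatom {n} {x} {y} {z} {b} {c} i xz zy b∈ b⋢z c∈ b⋢c = decidable-stable (z ⊑? c) λ z⋢c →
      ℕₚ.<-irrefl refl (subst₂ _≤_ total (atoms-count i) (length-mono (unique z⋢c) ⊆-atoms))
      where
      miss : Carrier → Carrier
      miss d with any? (λ a → ¬? (a ⊑? d)) (atoms x y)
      ... | yes p = proj₁ (find p)
      -- A default value, never reached when `d` is a coatom of `[x, y]`.
      ... | no _ = x
      miss-spec : ∀ {d} → d ∈ coatoms x y → miss d ∈ atoms x y × ¬ (miss d ⊑ d)
      miss-spec {d} d∈ with any? (λ a → ¬? (a ⊑? d)) (atoms x y)
      ... | yes p = proj₂ (find p)
      ... | no none = let a , a∈ , a⋢d = missing-atom i (coatom-interval i d∈) ≤-refl in ⊥-elim (none (lose a∈ a⋢d))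
      above : List Carrier
      above = c ∷ coatoms z y
      above-⊆ : ∀ {d} → d ∈ above → d ∈ coatoms x y
      above-⊆ (here refl) = c∈
      above-⊆ (there p) = let zd , dy , e = coatoms-∈ p in ∈-coatoms (⊑-trans xz zd) dy e
      ⊆-atoms : ∀ {a} → a ∈ map miss above ++ atoms x z → a ∈ atoms x y
      ⊆-atoms a∈ with ∈-++⁻ (map miss above) a∈
      ... | inj₂ p = atoms-⊆ zy p
      ... | inj₁ p with ∈-map⁻ miss p
      ... | d , d∈ , refl = proj₁ (miss-spec (above-⊆ d∈))
      miss-⋢z : ∀ {d} → d ∈ above → ¬ (miss d ⊑ z)
      miss-⋢z (there p) le = proj₂ (miss-spec (above-⊆ (there p))) (⊑-trans le (proj₁ (coatoms-∈ p)))
      -- The only atom missing from `c` is `b`, which is not below `z`.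
      miss-⋢z (here refl) le = b⋢z (subst (_⊑ z)
        (missing-atom-unique i c∈ (proj₁ (miss-spec c∈)) b∈ (proj₂ (miss-spec c∈)) b⋢c) le)
      unique : ¬ (z ⊑ c) → Unique (map miss above ++ atoms x z)
      unique z⋢c = ++⁺
        (unique-map-on miss (All.tabulate (λ { p refl → z⋢c (proj₁ (coatoms-∈ p)) }) ∷ coatoms-unique z y)
          λ p q e → missing-coatom-unique i (proj₁ (miss-spec (above-⊆ p))) (above-⊆ p) (above-⊆ q)
            (proj₂ (miss-spec (above-⊆ p))) (subst (λ a → ¬ (a ⊑ _)) (sym e) (proj₂ (miss-spec (above-⊆ q)))))
        (elems-unique 1 x z)
        λ { (p , q) → let d , d∈ , e = ∈-map⁻ miss p in miss-⋢z d∈ (subst (_⊑ z) e (atom-⊑ q)) }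
      -- The coatoms above `z` and the atoms below `z` number `n + 1` together; `c` adds one more.
      total : length (map miss above ++ atoms x z) ≡ suc (suc n)
      total = trans (length-++ (map miss above)) (trans (cong (_+ length (atoms x z)) (length-map miss above))
        (cong suc (trans (cong₂ _+_ (coatoms-count (zy , sym (ℕₚ.m∸n+n≡m (ρ-mono zy))))
            (atoms-count (xz , sym (ℕₚ.m∸n+n≡m (ρ-mono xz)))))
          (trans (sym (ℕₚ.+-∸-assoc (ρ y ∸ ρ z) (ρ-mono xz))) (trans (cong (_∸ ρ x) (ℕₚ.m∸n+n≡m (ρ-mono zy)))
            (trans (cong (_∸ ρ x) (proj₂ i)) (ℕₚ.m+n∸n≡m (suc n) (ρ x))))))))

    coatom-for : ∀ {n x y b} → IsInterval (suc n) x y → b ∈ atoms x y → ∃ λ c → c ∈ coatoms x y × ¬ (b ⊑ c)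
    coatom-for {n} i b∈ = missing-coatom i (proj₂ (elems-interval 1 n (proj₂ i) b∈)) ≤-refl (proj₁ (elems-∈ {1} b∈))

    -- If `w` is not the top, it misses an atom `b`, and so does `z`. By `⊑-coatom` both lie below a
    -- coatom `c` that misses `b`, and induction applies to `[x, c]`.
    atoms-reflect : ∀ n {x y z w} → IsInterval n x y → x ⊑ z → z ⊑ y → x ⊑ w → w ⊑ y →
      (∀ {a} → a ∈ atoms x y → a ⊑ z → a ⊑ w) → z ⊑ w
    atoms-reflect zero {w = w} (_ , ρy) xz zy xw _ _ =
      subst (_⊑ w) (ρ-injective xz (≤-trans (ρ-mono zy) (≤-reflexive ρy))) xw
    atoms-reflect (suc n) {x} {y} {z} {w} i xz zy xw wy sub with w ≟ y
    ... | yes refl = zy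
    ... | no w≢y =
      let b , b∈ , b⋢w = missing-atom i (xw , sym (ℕₚ.m∸n+n≡m (ρ-mono xw)))
            (subst (ρ w ∸ ρ x <_) (trans (cong (_∸ ρ x) (proj₂ i)) (ℕₚ.m+n∸n≡m (suc n) (ρ x)))
              (ℕₚ.∸-monoˡ-< (ρ-strict (wy , w≢y)) (ρ-mono xw)))
          c , c∈ , b⋢c = coatom-for i b∈
          b⋢z = λ bz → b⋢w (sub b∈ bz)
      in atoms-reflect n (coatom-interval i c∈) xz (⊑-coatom i xz zy b∈ b⋢z c∈ b⋢c)
           xw (⊑-coatom i xw wy b∈ b⋢w c∈ b⋢c)
           λ a∈ → sub (atoms-⊆ (proj₁ (proj₂ (coatoms-∈ c∈))) a∈)

    -- If `S` holds for all atoms, the top serves. Otherwise passing to a coatom that misses an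
    -- unselected atom `b` loses only `b`, and induction applies below that coatom.
    atoms-realise : ∀ n {x y} → IsInterval n x y → {S : Carrier → Set} → Decidable S →
      ∃ λ z → x ⊑ z × z ⊑ y × (∀ {a} → a ∈ atoms x y → (a ⊑ z) ⇔ S a)
    atoms-realise zero {x} {y} (xy , ρy) S? = x , ⊑-refl , xy , λ a∈ → ⊥-elim (no-atoms ρy a∈)
    atoms-realise (suc n) {x} {y} i {S} S? with any? (λ a → ¬? (S? a)) (atoms x y)
    ... | no none = y , proj₁ i , ⊑-refl , λ {a} a∈ → mk⇔
      (λ _ → decidable-stable (S? a) λ ¬Sa → none (lose a∈ ¬Sa)) (λ _ → atom-⊑ a∈)
    ... | yes some =
      let b , b∈ , ¬Sb = find some
          c , c∈ , b⋢c = coatom-for i b∈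
          z , xz , zc , spec = atoms-realise n (coatom-interval i c∈) S?
      in z , xz , ⊑-trans zc (proj₁ (proj₂ (coatoms-∈ c∈))) , extend b∈ ¬Sb c∈ b⋢c zc spec
      where
      extend : ∀ {b c z} → b ∈ atoms x y → ¬ S b → c ∈ coatoms x y → ¬ (b ⊑ c) → z ⊑ c →
        (∀ {a} → a ∈ atoms x c → (a ⊑ z) ⇔ S a) → ∀ {a} → a ∈ atoms x y → (a ⊑ z) ⇔ S a
      extend {b} {c} b∈ ¬Sb c∈ b⋢c zc spec {a} a∈ with a ⊑? c
      ... | yes ac = spec (atom-restrict a∈ ac)
      ... | no a⋢c with missing-atom-unique i c∈ a∈ b∈ a⋢c b⋢c
      ... | refl = mk⇔ (λ az → ⊥-elim (a⋢c (⊑-trans az zc))) (λ Sa → ⊥-elim (¬Sb Sa))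

    module BooleanIso {x y : Carrier} (xy : x ⊑ y) where

      -- The length of the atom list, so that `Fin n` indexes it directly; `atoms-count` later turns
      -- it into the rank difference.
      n : ℕ
      n = length (atoms x y)

      i : IsInterval n x y
      i = xy , trans (sym (ℕₚ.m∸n+n≡m (ρ-mono xy)))
        (cong (_+ ρ x) (sym (atoms-count (xy , sym (ℕₚ.m∸n+n≡m (ρ-mono xy))))))

      atom : Fin n → Carrier
      atom = lookup (atoms x y)

      atom-∈ : ∀ k → atom k ∈ atoms x y
      atom-∈ = ∈-lookup

      atom-index : ∀ {a} → a ∈ atoms x y → ∃ λ k → atom k ≡ a
      atom-index a∈ = Any.index a∈ , sym (Anyₚ.lookup-index a∈)

      selected? : (S : Subset n) → Decidable (λ a → ∃ λ k → atom k ≡ a × k Subset.∈ S)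
      selected? S a = Finₚ.any? λ k → (atom k ≟ a) ×-dec (k Subsetₚ.∈? S)

      embed : Subset n → Carrier
      embed S = proj₁ (atoms-realise n i (selected? S))

      embed-bounds : ∀ S → x ⊑ embed S × embed S ⊑ y
      embed-bounds S = let _ , p , q , _ = atoms-realise n i (selected? S) in p , q

      embed-atoms : ∀ S k → (atom k ⊑ embed S) ⇔ (k Subset.∈ S)
      embed-atoms S k = let _ , _ , _ , spec = atoms-realise n i (selected? S) in mk⇔
        (λ le → let k′ , e , k′∈ = Equivalence.to (spec (atom-∈ k)) le in
          subst (Subset._∈ S) (lookup-injective (elems-unique 1 x y) k′ k e) k′∈)
        (λ k∈ → Equivalence.from (spec (atom-∈ k)) (k , refl , k∈))

      reflect : ∀ {z w} → x ⊑ z × z ⊑ y → x ⊑ w × w ⊑ y → (∀ k → atom k ⊑ z → atom k ⊑ w) → z ⊑ w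
      reflect (xz , zy) (xw , wy) sub = atoms-reflect n i xz zy xw wy λ a∈ →
        let k , e = atom-index a∈ in subst (λ a → a ⊑ _ → a ⊑ _) e (sub k)

      embed-covers : ∀ z → x ⊑ z → z ⊑ y → ∃ λ S → embed S ≡ z
      -- With `S` the indices of the atoms below `z`, the elements `embed S` and `z` have the same
      -- atoms.
      embed-covers z xz zy = S , ⊑-antisym
        (reflect (embed-bounds S) (xz , zy) λ k le → to k (Equivalence.to (embed-atoms S k) le))
        (reflect (xz , zy) (embed-bounds S) λ k le → Equivalence.from (embed-atoms S k) (from k le))
        where
        S = tabulate λ k → does (atom k ⊑? z)
        to : ∀ k → k Subset.∈ S → atom k ⊑ z
        to k k∈ with atom k ⊑? z | trans (sym (Vecₚ.lookup∘tabulate (λ k → does (atom k ⊑? z)) k)) (Vecₚ.[]=⇒lookup k∈)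
        ... | yes le | _ = le
        ... | no _ | ()
        from : ∀ k → atom k ⊑ z → k Subset.∈ S
        from k le = Vecₚ.lookup⇒[]= k S (trans (Vecₚ.lookup∘tabulate (λ k → does (atom k ⊑? z)) k) (dec-true (atom k ⊑? z) le))

      embed-order : ∀ S T → (embed S ⊑ embed T) ⇔ (S ⊆B T)
      embed-order S T = mk⇔
        (λ le {k} k∈ → Equivalence.to (embed-atoms T k) (⊑-trans (Equivalence.from (embed-atoms S k) k∈) le))
        (λ sub → reflect (embed-bounds S) (embed-bounds T) λ k le →
          Equivalence.from (embed-atoms T k) (sub (Equivalence.to (embed-atoms S k) le)))

      boolean-iso : IntervalIso P x y (BoolAlg n) _⊆B_
      boolean-iso = embed , embed-bounds , embed-covers , embed-order

    boolean-intervals : ∀ x y → x ⊑ y → IntervalIso P x y (BoolAlg (ρ y ∸ ρ x)) _⊆B_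
    boolean-intervals x y xy = subst (λ n → IntervalIso P x y (BoolAlg n) _⊆B_)
      (atoms-count (xy , sym (ℕₚ.m∸n+n≡m (ρ-mono xy)))) (BooleanIso.boolean-iso xy)

theorem2p8 : (P : LFPoset) (ρ : LFPoset.Carrier P → ℕ) (B : ℕ → ℕ) →
    IsRankFunction P ρ → HasInfiniteChain P → IsFactorialFunction P ρ B →
    IsEulerian P ρ →
    let I = ((∀ n → B n ≡ n !) ×
             (∀ x y → LFPoset._≤_ P x y →
               IntervalIso P x y (BoolAlg (ρ y ∸ ρ x)) _⊆B_))
        II = ((B 0 ≡ 1) × (∀ n → B (suc n) ≡ 2 ^ n) ×
              (∀ x y → LFPoset._≤_ P x y → ρ x < ρ y →
                IntervalIso P x y (Butterfly (ρ y ∸ ρ x)) _≤T_))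
    in (I ⊎ II) × ¬ (I × II)
theorem2p8 P ρ B isRank chain fact eul =
  Sum.map
    (λ (B≡! , A≡id) → B≡! , BooleanIntervals.boolean-intervals A≡id)
    (λ (B≡2^ , A≡2) → B0 , B≡2^ , ButterflyIntervals.butterfly-intervals B≡2^ A≡2)
    classification ,
  -- The two factorial functions first differ at 3, where they are 6 and 4.
  λ ((B≡! , _) , (_ , B≡2^ , _)) → case trans (sym (B≡! 3)) (B≡2^ 2) of λ ()
  where open EulerianBinomial P ρ isRank B fact chain eul
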